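{- Let $k \geq 2$ be a fixed integer. Then, as $n \to \infty$, \[ \mathrm{ex^*}(n,B_{k,2}) = \begin{cases}\frac{k}{2}n + O(1) & \text{ if } k \text{ is odd}, \\ \frac{k-1}{2}n + O(1) & \text{ if } k \in\{2,4\},\\ \frac{k^2}{2(k+1)}n + O(1) & \text{ if } k \text{ is even and } k \geq 6, \end{cases} \] where $O(1)$ denotes a quantity bounded in absolute value by a constant depending only on $k$.
   Context: All graphs are finite and simple. An edge-coloring of a graph $G$ is a function $c: E(G) \to \mathbb{N}$; it is proper if no two edges sharing a vertex receive the same color. A subgraph is rainbow under $c$ if all its edges receive distinct colors. For a fixed graph $F$, a graph $G$ is rainbow-$F$-free under $c$ if $G$ contains no subgraph isomorphic to $F$ that is rainbow under $c$. The rainbow Turán number $\mathrm{ex^*}(n,F)$ is the maximum number of edges in an $n$-vertex graph $G$ that admits a proper edge-coloring under which $G$ is rainbow-$F$-free. For $k \geq 2$, the broom $B_{k,2}$ is the tree with $k$ edges obtained from a path $xyz$ with two edges (the handle) by attaching $k-2$ pendant edges (bristles) to the endpoint $z$; equivalently, it has a vertex $z$ of degree $k-1$, one of whose neighbors $y$ has one further neighbor $x$, and all other vertices are leaves adjacent to $z$. -}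

module Defs where

open import Data.Nat using (ℕ; zero; suc; _+_; _*_; _∸_; _≤_; _<_; _<?_)
open import Data.Bool using (Bool; true; false; _∨_; T)
open import Data.Bool.Properties using (∨-comm; T?)
open import Data.Fin using (Fin; toℕ)
open import Data.Fin.Properties using () renaming (_<?_ to _<ᶠ?_)
open import Data.List using (List; length; filter; allFin; cartesianProduct)
open import Data.Product using (Σ; ∃; ∃-syntax; _×_; _,_; proj₁; proj₂)
open import Data.Sum using (_⊎_)
open import Function.Definitions using (Injective)
open import Relation.Binary.PropositionalEquality using (_≡_; _≢_; refl)
open import Relation.Nullary using (¬_)
open import Relation.Nullary.Decidable using (_×-dec_)

record Graph (n : ℕ) : Set where
  field
    adj    : Fin n → Fin n → Bool
    sym    : ∀ i j → adj i j ≡ adj j i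
    irrefl : ∀ i → adj i i ≡ false
open Graph public

Edge : ∀ {n} → Graph n → Fin n → Fin n → Set
Edge G u v = T (adj G u v)

edgeCount : ∀ {n} → Graph n → ℕ
edgeCount {n} G =
  length (filter (λ p → (proj₁ p <ᶠ? proj₂ p) ×-dec T? (adj G (proj₁ p) (proj₂ p)))
                 (cartesianProduct (allFin n) (allFin n)))

-- An edge-colouring: the colour of edge uv is c u v (only values on edges
-- matter; it must be symmetric on edges so that it is a function of the edge).
Colouring : ℕ → Set
Colouring n = Fin n → Fin n → ℕ

Proper : ∀ {n} → Graph n → Colouring n → Set
Proper G c =
  (∀ u v → Edge G u v → c u v ≡ c v u) ×
  (∀ u v w → Edge G u v → Edge G u w → v ≢ w → c u v ≢ c u w)

RainbowCopy : ∀ {n p} → Graph n → Colouring n → Graph p → Set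
RainbowCopy {n} {p} G c F =
  Σ (Fin p → Fin n) λ φ →
    Injective _≡_ _≡_ φ ×
    (∀ a b → Edge F a b → Edge G (φ a) (φ b)) ×
    (∀ a b a' b' → Edge F a b → Edge F a' b' →
       c (φ a) (φ b) ≡ c (φ a') (φ b') →
       (a ≡ a' × b ≡ b') ⊎ (a ≡ b' × b ≡ a'))

RainbowFree : ∀ {n p} → Graph n → Colouring n → Graph p → Set
RainbowFree G c F = ¬ RainbowCopy G c F

-- m is the number of edges of some n-vertex graph admitting a proper
-- edge-colouring under which it is rainbow-F-free.  ex*(n,F) is the maximum
-- of such m.
Admissible : ∀ {p} → ℕ → Graph p → ℕ → Set
Admissible n F m =
  Σ (Graph n) λ G → Σ (Colouring n) λ c →
    Proper G c × RainbowFree G c F × edgeCount G ≡ m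

-- The broom B_{k,2} on vertex set Fin (k + 1): vertex 0 = x, 1 = y, 2 = z,
-- vertices 3 , … , k are the leaves (bristles) attached to z.
-- Edges: x y, y z, and z ℓ for each leaf ℓ (k edges in total).
broomArc : ℕ → ℕ → Bool
broomArc 0 1 = true
broomArc 1 2 = true
broomArc 2 (suc (suc (suc _))) = true
broomArc _ _ = false

broomAdjℕ : ℕ → ℕ → Bool
broomAdjℕ a b = broomArc a b ∨ broomArc b a

broomArc-irrefl : ∀ a → broomArc a a ≡ false
broomArc-irrefl 0 = refl
broomArc-irrefl 1 = refl
broomArc-irrefl 2 = refl
broomArc-irrefl (suc (suc (suc _))) = refl

broom-irrefl : ∀ a → broomAdjℕ a a ≡ false
broom-irrefl a rewrite broomArc-irrefl a = refl

broom : (k : ℕ) → Graph (suc k)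
broom k = record
  { adj    = λ i j → broomAdjℕ (toℕ i) (toℕ j)
  ; sym    = λ i j → ∨-comm (broomArc (toℕ i) (toℕ j)) (broomArc (toℕ j) (toℕ i))
  ; irrefl = λ i → broom-irrefl (toℕ i)
  }

-- "ex*(n , B_{k,2}) = (a / b) n + O(1)" (with b > 0), where the O(1) term is
-- bounded by a constant depending only on k: there is C such that for every n
--   * every admissible m satisfies  b m ≤ a n + C   (ex* ≤ (a/b) n + C/b), and
--   * some admissible m satisfies  a n ≤ b m + C   (ex* ≥ (a/b) n − C/b).
ExStarBroomAsymp : (k a b : ℕ) → Set
ExStarBroomAsymp k a b =
  ∃[ C ] ∀ n →
    (∀ m → Admissible n (broom k) m → b * m ≤ a * n + C) ×
    (∃[ m ] Admissible n (broom k) m × a * n ≤ b * m + C)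

Odd : ℕ → Set
Odd k = ∃[ j ] k ≡ suc (2 * j)

Even : ℕ → Set
Even k = ∃[ j ] k ≡ 2 * j

{-# OPTIONS --safe #-}

-- Upper bounds. If a vertex z has degree at least k + 1, then all its neighbours are leaves. If z has
-- degree k, then z and its neighbours form a component, on k + 1 vertices, whose edges carry only the
-- k colours at z. For even k each colour misses one of these k + 1 vertices, so their degrees sum to
-- at most k², and for k = 4 to at most 15. The vertices of smaller degree are harmless on average.
--
-- Lower bounds. In a graph on k + 1 vertices properly coloured with k colours, a rainbow broom would
-- be spanning and use every colour, so its centre z and its end x cannot be adjacent, and x must be
-- the only non-neighbour of z. For odd k take copies of K_{k+1}. For even k = 2m ≥ 6 take copies of
-- K_{k+1} minus an m-cycle, where each vertex has either no or two non-neighbours. It has a proper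
-- colouring with k colours, obtained from the standard 1-factorisation of K_{2m} by recolouring a
-- matching, deleting the cycle and joining a new vertex to all others.

module Submission where

open import Defs hiding (sym)
open import Data.Bool using (Bool; true; false; _∧_; _∨_; not; T; if_then_else_)
open import Data.Bool.Properties using (T?; ∨-comm)
open import Data.Empty using (⊥; ⊥-elim)
open import Data.Fin using (Fin; zero; suc; toℕ)
import Data.Fin as Fin
open import Data.Fin.Permutation using (permutation)
import Data.Fin.Properties as Fin
open import Data.List using (_∷_; length; filter; cartesianProduct; tabulate)
import Data.List as List
open import Data.List.Properties using (filter-++; length-++)
open import Data.Nat
open import Data.Nat.Coprimality using (Coprime; coprime-divisor)
open import Data.Nat.DivMod using (_/_; _%_; m≡m%n+[m/n]*n; m%n<n; [m+kn]%n≡m%n)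
open import Data.Nat.Divisibility using (_∣_; ∣⇒≤; ∣m+n∣m⇒∣n; n∣m*n; ∣1⇒≡1; ∣-trans)
open import Data.Nat.Properties
open import Algebra.Properties.Semiring.Sum +-*-semiring using (sum; sum-cong-≗; ∑-distrib-+; ∑-comm; sum-permute; *-distribˡ-sum)
open import Data.Nat.Tactic.RingSolver using (solve-∀)
open import Data.Product using (∃; _×_; _,_; proj₁; proj₂)
open import Data.Sum using (_⊎_; inj₁; inj₂)
open import Data.Unit using (tt)
open import Function using (_∘_; id)
open import Function.Definitions using (Injective)
open import Level using (0ℓ)
open import Relation.Binary.Definitions using (tri<; tri≈; tri>)
open import Relation.Binary.PropositionalEquality
open import Relation.Nullary using (¬_; does; yes; no)
open import Relation.Nullary.Decidable using (dec-true; dec-false; _×-dec_)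
open import Relation.Unary using (Pred; Decidable)

-- For even k the degree bound k² on k + 1 vertices says how much the extremal graph may lose:
-- exactly k/2 of the edges of K_{k+1}. No vertex may be left with a single non-neighbour, so every
-- vertex that loses an edge must lose two. A cycle on m = k/2 vertices does both, and it exists
-- only for m ≥ 3, which is where k ≥ 6 comes from.
--
-- The delicate point of its colouring is the new vertex `u`. The colours freed at the other
-- vertices go to the edges at `u`, so they must be pairwise distinct. The old colours are sums of
-- residues modulo n = 2m - 1. Hence the task is to place all n residues on an m-cycle with a
-- pendant vertex at every cycle vertex but one, so that the n edge sums are distinct modulo n. This
-- is a harmonious labelling of that graph. Odd and even m need different labellings, since
-- consecutive labels round the cycle give a repeated sum when m is even.

ind : Bool → ℕ
ind b = if b then 1 else 0

ind-T : ∀ {b} → T b → ind b ≡ 1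
ind-T {true} _ = refl

ind-¬T : ∀ {b} → ¬ T b → ind b ≡ 0
ind-¬T {false} _ = refl
ind-¬T {true} ¬b = ⊥-elim (¬b tt)

T-ind : ∀ {b} → ind b ≢ 0 → T b
T-ind {true}  _  = tt
T-ind {false} ≢0 = ⊥-elim (≢0 refl)

ind≤1 : ∀ b → ind b ≤ 1
ind≤1 true  = ≤-refl
ind≤1 false = z≤n

ind-mono : ∀ {a b} → (T a → T b) → ind a ≤ ind b
ind-mono {false} f = z≤n
ind-mono {true} {true} f = ≤-refl
ind-mono {true} {false} f = ⊥-elim (f tt)

-- Counting and summing over `Fin n`

count : ∀ {n} → (Fin n → Bool) → ℕ
count P = sum (ind ∘ P)

_==_ : ∀ {n} → Fin n → Fin n → Bool
i == j = does (i Fin.≟ j)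

T-== : ∀ {n} {i j : Fin n} → T (i == j) → i ≡ j
T-== {i = i} {j} t with i Fin.≟ j
... | yes e = e

==-T : ∀ {n} {i j : Fin n} → i ≡ j → T (i == j)
==-T {i = i} {j} e with i Fin.≟ j
... | yes _ = tt
... | no ¬e = ¬e e

sum-mono : ∀ {n} {f g : Fin n → ℕ} → (∀ i → f i ≤ g i) → sum f ≤ sum g
sum-mono {zero}  f≤g = z≤n
sum-mono {suc n} f≤g = +-mono-≤ (f≤g zero) (sum-mono (f≤g ∘ suc))

sum-const : ∀ n c → sum {n} (λ _ → c) ≡ n * c
sum-const zero    c = refl
sum-const (suc n) c = cong (c +_) (sum-const n c)

sum-≡0 : ∀ {n} {f : Fin n → ℕ} → (∀ i → f i ≡ 0) → sum f ≡ 0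
sum-≡0 {n} f≡0 = trans (sum-cong-≗ f≡0) (trans (sum-const n 0) (*-zeroʳ n))

sum-δ : ∀ {n} (c : Fin n) (f : Fin n → ℕ) → sum (λ i → ind (i == c) * f i) ≡ f c
sum-δ {suc n} zero f = begin
  1 * f zero + sum {n} (λ i → 0)  ≡⟨ cong₂ _+_ (*-identityˡ (f zero)) (sum-≡0 {n} (λ i → refl)) ⟩
  f zero + 0                      ≡⟨ +-identityʳ (f zero) ⟩
  f zero                          ∎
  where open ≡-Reasoning
sum-δ (suc c) f = sum-δ c (f ∘ suc)

count-== : ∀ {n} (c : Fin n) → count (_== c) ≡ 1
count-== c = trans (sum-cong-≗ (λ i → sym (*-identityʳ (ind (i == c))))) (sum-δ c (λ _ → 1))

count≤1 : ∀ {n} (P : Fin n → Bool) → (∀ i j → T (P i) → T (P j) → i ≡ j) → count P ≤ 1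
count≤1 P unique with Fin.any? (T? ∘ P)
... | yes (c , Pc) =
  ≤-trans (sum-mono (λ i → ind-mono (λ Pi → ==-T (unique i c Pi Pc)))) (≤-reflexive (count-== c))
... | no ∄ = ≤-trans (≤-reflexive (sum-≡0 (λ i → ind-¬T (λ Pi → ∄ (i , Pi))))) z≤n

-- Turns a Boolean subset into an indexed family. Bristles are chosen from it, and a neighbourhood
-- becomes the vertex set of a graph of its own.
enumerate : ∀ {n} (P : Fin n → Bool) → ∃ λ (f : Fin (count P) → Fin n) →
  Injective _≡_ _≡_ f × (∀ i → T (P (f i))) × (∀ v → T (P v) → ∃ λ i → f i ≡ v)
enumerate {zero}  P = (λ ()) , (λ {}) , (λ ()) , λ ()
enumerate {suc n} P with P zero in eq | enumerate (P ∘ suc)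
... | true | f , f-inj , Pf , f-sur = g , (λ {a} {b} → g-inj a b) , Pg , g-sur
  where
  g : Fin (suc (count (P ∘ suc))) → Fin (suc n)
  g zero    = zero
  g (suc i) = suc (f i)
  g-inj : ∀ a b → g a ≡ g b → a ≡ b
  g-inj zero    zero    _ = refl
  g-inj (suc a) (suc b) e = cong suc (f-inj (Fin.suc-injective e))
  Pg : ∀ i → T (P (g i))
  Pg zero    = subst T (sym eq) tt
  Pg (suc i) = Pf i
  g-sur : ∀ v → T (P v) → ∃ λ i → g i ≡ v
  g-sur zero    _  = zero , refl
  g-sur (suc v) Pv with f-sur v Pv
  ... | i , e = suc i , cong suc e
... | false | f , f-inj , Pf , f-sur = suc ∘ f , (λ e → f-inj (Fin.suc-injective e)) , Pf , g-sur
  where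
  g-sur : ∀ v → T (P v) → ∃ λ i → suc (f i) ≡ v
  g-sur zero    Pv = ⊥-elim (subst T eq Pv)
  g-sur (suc v) Pv with f-sur v Pv
  ... | i , e = i , cong suc e

choose : ∀ {n} j (P : Fin n → Bool) → j ≤ count P →
  ∃ λ (f : Fin j → Fin n) → Injective _≡_ _≡_ f × (∀ i → T (P (f i)))
choose j P j≤ with enumerate P
... | f , f-inj , Pf , _ =
  (λ i → f (Fin.inject≤ i j≤)) , (λ e → Fin.inject≤-injective j≤ j≤ _ _ (f-inj e)) , λ i → Pf _

witness : ∀ {n} (P : Fin n → Bool) → count P ≢ 0 → ∃ λ v → T (P v)
witness P ≢0 with choose 1 P (n≢0⇒n>0 ≢0)
... | f , _ , Pf = f zero , Pf zero

-- The indicator of `i` still fits under the bound `b` when added to `f`, and it raises the sum by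
-- one.
sum-strict : ∀ {n} {f : Fin n → ℕ} b → (∀ i → f i ≤ b) → ∀ i → f i < b → sum f < n * b
sum-strict {n} {f} b f≤b i fi<b = begin-strict
  sum f                              <⟨ m<m+n (sum f) z<s ⟩
  sum f + 1                          ≡⟨ cong (sum f +_) (count-== i) ⟨
  sum f + count (_== i)              ≡⟨ ∑-distrib-+ f (λ j → ind (j == i)) ⟨
  sum (λ j → f j + ind (j == i))     ≤⟨ sum-mono pointwise ⟩
  sum {n} (λ _ → b)                  ≡⟨ sum-const n b ⟩
  n * b                              ∎
  where
  open ≤-Reasoning
  pointwise : ∀ j → f j + ind (j == i) ≤ b
  pointwise j with j Fin.≟ i
  ... | yes refl = ≤-trans (≤-reflexive (+-comm (f j) 1)) fi<b
  ... | no _     = ≤-trans (≤-reflexive (+-identityʳ (f j))) (f≤b j)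

-- After the indicator of `j` is added, `i ≢ j` keeps the deficit at `i` intact, so `sum-strict`
-- applies once more.
sum-strict₂ : ∀ {n} {f : Fin n → ℕ} b → (∀ i → f i ≤ b) → ∀ i j → i ≢ j → f i < b → f j < b →
  suc (sum f) < n * b
sum-strict₂ {n} {f} b f≤b i j i≢j fi<b fj<b = begin-strict
  suc (sum f)                        ≡⟨ +-comm 1 (sum f) ⟩
  sum f + 1                          ≡⟨ cong (sum f +_) (count-== j) ⟨
  sum f + count (_== j)              ≡⟨ ∑-distrib-+ f (λ v → ind (v == j)) ⟨
  sum (λ v → f v + ind (v == j))     <⟨ sum-strict b pointwise i at-i ⟩
  n * b                              ∎
  where
  open ≤-Reasoning
  pointwise : ∀ v → f v + ind (v == j) ≤ b
  pointwise v with v Fin.≟ j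
  ... | yes refl = ≤-trans (≤-reflexive (+-comm (f v) 1)) fj<b
  ... | no _     = ≤-trans (≤-reflexive (+-identityʳ (f v))) (f≤b v)
  at-i : f i + ind (i == j) < b
  at-i with i Fin.≟ j
  ... | yes i≡j = ⊥-elim (i≢j i≡j)
  ... | no _    = subst (_< b) (sym (+-identityʳ (f i))) fi<b

-- Each nonzero `f i` reappears as the term of one of its preimages. Exchanging the sums over pairs
-- with `i == g a` turns this into the bound.
sum-image : ∀ {m n} (f : Fin n → ℕ) (g : Fin m → Fin n) →
  (∀ i → f i ≢ 0 → ∃ λ a → g a ≡ i) → sum f ≤ sum (f ∘ g)
sum-image f g covers = begin
  sum f                                      ≤⟨ sum-mono pointwise ⟩
  sum (λ i → sum (λ a → ind (i == g a) * f i)) ≡⟨ ∑-comm (λ i a → ind (i == g a) * f i) ⟩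
  sum (λ a → sum (λ i → ind (i == g a) * f i)) ≡⟨ sum-cong-≗ (λ a → sum-δ (g a) f) ⟩
  sum (f ∘ g)                                ∎
  where
  open ≤-Reasoning
  term : ∀ {m} (h : Fin m → ℕ) a → h a ≤ sum h
  term h zero    = m≤m+n (h zero) _
  term h (suc a) = ≤-trans (term (h ∘ suc) a) (m≤n+m _ (h zero))
  pointwise : ∀ i → f i ≤ sum (λ a → ind (i == g a) * f i)
  pointwise i with f i ≟ 0
  ... | yes e = ≤-trans (≤-reflexive e) z≤n
  ... | no ≢0 with covers i ≢0
  ... | a , refl = ≤-trans
          (≤-reflexive (sym (trans (cong (_* f i) (ind-T (==-T {i = i} refl))) (*-identityˡ (f i)))))
          (term (λ b → ind (g a == g b) * f i) a)

sum-↑ : ∀ m {n} (f : Fin (m + n) → ℕ) →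
  sum f ≡ sum (λ i → f (i Fin.↑ˡ n)) + sum (λ j → f (m Fin.↑ʳ j))
sum-↑ zero    f = refl
sum-↑ (suc m) f = trans (cong (f zero +_) (sum-↑ m (f ∘ suc))) (sym (+-assoc (f zero) _ _))

-- Degrees and the handshake identity

degree : ∀ {n} → Graph n → Fin n → ℕ
degree G v = count (adj G v)

degreeSum : ∀ {n} → Graph n → ℕ
degreeSum G = sum (degree G)

length-filter-∷ : ∀ {A : Set} {P : Pred A 0ℓ} (P? : Decidable P) x xs →
  length (filter P? (x ∷ xs)) ≡ ind (does (P? x)) + length (filter P? xs)
length-filter-∷ P? x xs with does (P? x)
... | true  = refl
... | false = refl

length-filter-tabulate : ∀ {A B : Set} {P : Pred B 0ℓ} (P? : Decidable P) (h : A → B) {n} (g : Fin n → A) →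
  length (filter P? (List.map h (tabulate g))) ≡ count (λ j → does (P? (h (g j))))
length-filter-tabulate P? h {zero}  g = refl
length-filter-tabulate P? h {suc n} g =
  trans (length-filter-∷ P? _ _) (cong (ind (does (P? (h (g zero)))) +_) (length-filter-tabulate P? h (g ∘ suc)))

length-filter-product : ∀ {A B : Set} {P : Pred (A × B) 0ℓ} (P? : Decidable P) {m n}
  (f : Fin m → A) (g : Fin n → B) →
  length (filter P? (cartesianProduct (tabulate f) (tabulate g))) ≡
  sum (λ i → count (λ j → does (P? (f i , g j))))
length-filter-product P? {zero}  f g = refl
length-filter-product P? {suc m} f g =
  trans (cong length (filter-++ P? (List.map (f zero ,_) (tabulate g)) _))
  (trans (length-++ (filter P? (List.map (f zero ,_) (tabulate g))))
  (cong₂ _+_ (length-filter-tabulate P? (f zero ,_) g) (length-filter-product P? (f ∘ suc) g)))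

-- `edgeCount` counts pairs with `i < j`; adding the transposed count meets every ordered adjacent
-- pair exactly once.
handshake : ∀ {n} (G : Graph n) → 2 * edgeCount G ≡ degreeSum G
handshake {n} G = begin
  2 * edgeCount G
    ≡⟨ cong (2 *_) (length-filter-product edge? id id) ⟩
  2 * S
    ≡⟨ cong (S +_) (+-identityʳ S) ⟩
  S + S
    ≡⟨ cong (S +_) (∑-comm up) ⟩
  S + sum (λ i → sum (λ j → up j i))
    ≡⟨ ∑-distrib-+ (λ i → sum (up i)) (λ i → sum (λ j → up j i)) ⟨
  sum (λ i → sum (up i) + sum (λ j → up j i))
    ≡⟨ sum-cong-≗ (λ i → sym (∑-distrib-+ (up i) (λ j → up j i))) ⟩
  sum (λ i → sum (λ j → up i j + up j i))
    ≡⟨ sum-cong-≗ (λ i → sum-cong-≗ (both i)) ⟩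
  degreeSum G ∎
  where
  open ≡-Reasoning
  edge? = λ (p : Fin n × Fin n) → (proj₁ p Fin.<? proj₂ p) ×-dec T? (adj G (proj₁ p) (proj₂ p))
  up : Fin n → Fin n → ℕ
  up i j = ind (does (i Fin.<? j) ∧ adj G i j)
  S = sum (λ i → sum (up i))
  both : ∀ i j → up i j + up j i ≡ ind (adj G i j)
  both i j with Fin.<-cmp i j
  ... | tri< i<j _ j≮i rewrite dec-true (i Fin.<? j) i<j | dec-false (j Fin.<? i) j≮i = +-identityʳ _
  ... | tri> i≮j _ j<i rewrite dec-true (j Fin.<? i) j<i | dec-false (i Fin.<? j) i≮j =
        cong ind (Graph.sym G j i)
  ... | tri≈ i≮i refl _ rewrite dec-false (i Fin.<? i) i≮i = sym (cong ind (irrefl G i))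

-- Bounding the degree sum component by component

T-∧⁺ : ∀ {a b} → T a → T b → T (a ∧ b)
T-∧⁺ {true} {true} _ _ = tt

T-∧⁻ : ∀ {a b} → T (a ∧ b) → T a × T b
T-∧⁻ {true} {true} _ = tt , tt

T-∨⁻ : ∀ {a b} → T (a ∨ b) → T a ⊎ T b
T-∨⁻ {true} _ = inj₁ tt
T-∨⁻ {false} t = inj₂ t

T-∨ˡ : ∀ {a b} → T a → T (a ∨ b)
T-∨ˡ {true} _ = tt

T-∨ʳ : ∀ {a b} → T b → T (a ∨ b)
T-∨ʳ {true} _ = tt
T-∨ʳ {false} t = t

T-not : ∀ {b} → ¬ T b → T (not b)
T-not {false} _ = tt
T-not {true} ¬t = ¬t tt

not-T : ∀ {b} → T (not b) → ¬ T b
not-T {false} _ ()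

edge-sym : ∀ {n} (G : Graph n) {u v} → Edge G u v → Edge G v u
edge-sym G {u} {v} = subst T (Graph.sym G u v)

edge-≢ : ∀ {n} (G : Graph n) {u v} → Edge G u v → u ≢ v
edge-≢ G {u} e refl = subst T (irrefl G u) e

-- The search follows the given disjunctions, so it works for the `Light` and `Heavy` below without
-- a decision procedure for them.
all⊎any : ∀ {n} {A B : Fin n → Set} (S : Fin n → Bool) → (∀ v → A v ⊎ B v) →
  (∀ v → T (S v) → A v) ⊎ ∃ λ v → T (S v) × B v
all⊎any {zero}  S f = inj₁ λ ()
all⊎any {suc n} S f with T? (S zero) | f zero | all⊎any (S ∘ suc) (f ∘ suc)
... | _      | _      | inj₂ (v , p) = inj₂ (suc v , p)
... | yes s  | inj₂ b | inj₁ _       = inj₂ (zero , s , b)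
... | yes s  | inj₁ a | inj₁ g       = inj₁ λ { zero _ → a ; (suc v) → g v }
... | no ¬s  | _      | inj₁ g       = inj₁ λ { zero s → ⊥-elim (¬s s) ; (suc v) → g v }

module _ {n} (G : Graph n) where

  nbhd : Fin n → Fin n → Bool
  nbhd z v = (v == z) ∨ adj G z v

  nbhd-self : ∀ z → T (nbhd z z)
  nbhd-self z = T-∨ˡ (==-T {i = z} refl)

  Closed : (Fin n → Bool) → Set
  Closed S = ∀ v w → T (S v) → Edge G v w → T (S w)

  degreesOver : (Fin n → Bool) → ℕ
  degreesOver S = sum (λ v → ind (S v) * degree G v)

  count-nbhd : ∀ z → count (nbhd z) ≡ suc (degree G z)
  count-nbhd z = trans (sum-cong-≗ split)
    (trans (∑-distrib-+ (λ v → ind (v == z)) (λ v → ind (adj G z v))) (cong (_+ degree G z) (count-== z)))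
    where
    split : ∀ v → ind (nbhd z v) ≡ ind (v == z) + ind (adj G z v)
    split v with v Fin.≟ z
    ... | yes refl rewrite irrefl G v = refl
    ... | no _ = refl

  module _ (p q : ℕ) where

    -- The target for the average degree is `p / q`, kept as a fraction because k²/(k+1) is not an
    -- integer. A heavy vertex has a closed neighbourhood that no edge leaves and that meets the
    -- target as a whole, whatever its single degrees are.
    Light Heavy : Fin n → Set
    Light v = q * degree G v ≤ p
    Heavy z = Closed (nbhd z) × q * degreesOver (nbhd z) ≤ p * count (nbhd z)

    -- If all of `S` is light, the bound holds term by term. Otherwise the closed neighbourhood of a
    -- heavy vertex is split off, both sides of the inequality add up, and the smaller rest is again
    -- closed; `fuel` makes this recursion structural.
    closed-bound : (∀ v → Light v ⊎ Heavy v) → ∀ fuel S → count S ≤ fuel → Closed S →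
      q * degreesOver S ≤ p * count S
    closed-bound light⊎heavy fuel S S≤fuel closed with all⊎any S light⊎heavy
    ... | inj₁ light = begin
      q * degreesOver S                        ≡⟨ *-distribˡ-sum q (λ v → ind (S v) * degree G v) ⟩
      sum (λ v → q * (ind (S v) * degree G v)) ≤⟨ sum-mono pointwise ⟩
      sum (λ v → p * ind (S v))                ≡⟨ *-distribˡ-sum p (ind ∘ S) ⟨
      p * count S                              ∎
      where
      open ≤-Reasoning
      pointwise : ∀ v → q * (ind (S v) * degree G v) ≤ p * ind (S v)
      pointwise v with S v in eq
      ... | false = ≤-trans (≤-reflexive (*-zeroʳ q)) z≤n
      ... | true = ≤-trans (≤-reflexive (cong (q *_) (*-identityˡ _)))
              (≤-trans (light v (subst T (sym eq) tt)) (≤-reflexive (sym (*-identityʳ p))))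
    ... | inj₂ (z , Sz , N-closed , N-bound) = go fuel S≤fuel
      where
      S′ : Fin n → Bool
      S′ v = S v ∧ not (nbhd z v)
      N⊆S : ∀ v → T (nbhd z v) → T (S v)
      N⊆S v t with T-∨⁻ {v == z} t
      ... | inj₁ v==z = subst (T ∘ S) (sym (T-== v==z)) Sz
      ... | inj₂ e    = closed z v Sz e
      -- An edge from `S′` into the removed neighbourhood, read backwards, would put its starting
      -- point there too.
      S′-closed : Closed S′
      S′-closed v w S′v e with T-∧⁻ {S v} S′v
      ... | Sv , v∉N = T-∧⁺ (closed v w Sv e) (T-not (λ w∈N → not-T v∉N (N-closed w v w∈N (edge-sym G e))))
      split : ∀ v → ind (S v) ≡ ind (S′ v) + ind (nbhd z v)
      split v with S v in eq | nbhd z v in eq′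
      ... | true  | true  = refl
      ... | true  | false = refl
      ... | false | false = refl
      ... | false | true  = ⊥-elim (subst T eq (N⊆S v (subst T (sym eq′) tt)))
      count-split : count S ≡ count S′ + count (nbhd z)
      count-split = trans (sum-cong-≗ split) (∑-distrib-+ (ind ∘ S′) (ind ∘ nbhd z))
      degrees-split : degreesOver S ≡ degreesOver S′ + degreesOver (nbhd z)
      degrees-split = trans
        (sum-cong-≗ (λ v → trans (cong (_* degree G v) (split v))
                                 (*-distribʳ-+ (degree G v) (ind (S′ v)) (ind (nbhd z v)))))
        (∑-distrib-+ (λ v → ind (S′ v) * degree G v) (λ v → ind (nbhd z v) * degree G v))
      smaller : count S′ < count S
      smaller = begin-strict
        count S′                           <⟨ m<m+n (count S′) z<s ⟩
        count S′ + suc (degree G z)        ≡⟨ cong (count S′ +_) (count-nbhd z) ⟨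
        count S′ + count (nbhd z)          ≡⟨ count-split ⟨
        count S                            ∎
        where open ≤-Reasoning
      go : ∀ fuel → count S ≤ fuel → q * degreesOver S ≤ p * count S
      go zero       S≤0 = ⊥-elim (n≮0 (≤-trans smaller S≤0))
      go (suc fuel) S≤  = begin
        q * degreesOver S                            ≡⟨ cong (q *_) degrees-split ⟩
        q * (degreesOver S′ + degreesOver (nbhd z))  ≡⟨ *-distribˡ-+ q (degreesOver S′) _ ⟩
        q * degreesOver S′ + q * degreesOver (nbhd z)
          ≤⟨ +-mono-≤ (closed-bound light⊎heavy fuel S′ (s≤s⁻¹ (≤-trans smaller S≤)) S′-closed) N-bound ⟩
        p * count S′ + p * count (nbhd z)            ≡⟨ *-distribˡ-+ p (count S′) _ ⟨
        p * (count S′ + count (nbhd z))              ≡⟨ cong (p *_) count-split ⟨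
        p * count S                                  ∎
        where open ≤-Reasoning

    degreeSum-bound : (∀ v → Light v ⊎ Heavy v) → q * degreeSum G ≤ p * n
    degreeSum-bound light⊎heavy = begin
      q * degreeSum G               ≡⟨ cong (q *_) (sum-cong-≗ (λ v → sym (*-identityˡ (degree G v)))) ⟩
      q * degreesOver (λ _ → true)  ≤⟨ closed-bound light⊎heavy _ (λ _ → true) ≤-refl (λ _ _ _ _ → tt) ⟩
      p * count {n} (λ _ → true)    ≡⟨ cong (p *_) (trans (sum-const n 1) (*-identityʳ n)) ⟩
      p * n                         ∎
      where open ≤-Reasoning

-- Rainbow brooms

-- One orientation for each edge of the broom, so that the rainbow condition is checked on arcs and
-- symmetry supplies the rest.
data Arc {l} : Fin (3 + l) → Fin (3 + l) → Set where
  handle : Arc zero (suc zero)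
  neck   : Arc (suc zero) (suc (suc zero))
  bristle : ∀ i → Arc (suc (suc zero)) (suc (suc (suc i)))

arc : ∀ {l} (a b : Fin (3 + l)) → Edge (broom (2 + l)) a b → Arc a b ⊎ Arc b a
arc zero (suc zero) _ = inj₁ handle
arc zero (suc (suc zero)) ()
arc zero (suc (suc (suc _))) ()
arc (suc zero) zero _ = inj₂ handle
arc (suc zero) (suc (suc zero)) _ = inj₁ neck
arc (suc (suc zero)) (suc zero) _ = inj₂ neck
arc (suc (suc zero)) (suc (suc (suc i))) _ = inj₁ (bristle i)
arc (suc (suc (suc i))) (suc (suc zero)) _ = inj₂ (bristle i)

module _ {n} (G : Graph n) (c : Colouring n) (proper : Proper G c) where

  c-sym : ∀ {u v} → Edge G u v → c u v ≡ c v u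
  c-sym = proj₁ proper _ _

  c-inj : ∀ {u v w} → Edge G u v → Edge G u w → c u v ≡ c u w → v ≡ w
  c-inj {u} {v} {w} e e′ eq with v Fin.≟ w
  ... | yes v≡w = v≡w
  ... | no v≢w = ⊥-elim (proj₂ proper u v w e e′ v≢w eq)

  -- Properness separates the colours of edges that meet. In a broom only `xy` and a bristle are
  -- disjoint, hence the single hypothesis about colours.
  broomCopy : ∀ {l} x y z → Edge G z y → Edge G y x → x ≢ z →
    (f : Fin l → Fin n) → Injective _≡_ _≡_ f →
    (∀ i → Edge G z (f i)) → (∀ i → f i ≢ x) → (∀ i → f i ≢ y) → (∀ i → c z (f i) ≢ c x y) →
    RainbowCopy G c (broom (2 + l))
  broomCopy {l} x y z zy yx x≢z f f-inj zf f≢x f≢y fc = φ , (λ {a} {b} → φ-inj a b) , hom , rainbow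
    where
    y≢x = edge-≢ G yx
    z≢y = edge-≢ G zy
    xy = edge-sym G yx
    yz = edge-sym G zy
    φ : Fin (3 + l) → Fin n
    φ zero                = x
    φ (suc zero)          = y
    φ (suc (suc zero))    = z
    φ (suc (suc (suc i))) = f i
    φ-inj : ∀ a b → φ a ≡ φ b → a ≡ b
    φ-inj zero zero _ = refl
    φ-inj zero (suc zero) e = ⊥-elim (y≢x (sym e))
    φ-inj zero (suc (suc zero)) e = ⊥-elim (x≢z e)
    φ-inj zero (suc (suc (suc j))) e = ⊥-elim (f≢x j (sym e))
    φ-inj (suc zero) zero e = ⊥-elim (y≢x e)
    φ-inj (suc zero) (suc zero) _ = refl
    φ-inj (suc zero) (suc (suc zero)) e = ⊥-elim (z≢y (sym e))
    φ-inj (suc zero) (suc (suc (suc j))) e = ⊥-elim (f≢y j (sym e))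
    φ-inj (suc (suc zero)) zero e = ⊥-elim (x≢z (sym e))
    φ-inj (suc (suc zero)) (suc zero) e = ⊥-elim (z≢y e)
    φ-inj (suc (suc zero)) (suc (suc zero)) _ = refl
    φ-inj (suc (suc zero)) (suc (suc (suc j))) e = ⊥-elim (edge-≢ G (zf j) e)
    φ-inj (suc (suc (suc i))) zero e = ⊥-elim (f≢x i e)
    φ-inj (suc (suc (suc i))) (suc zero) e = ⊥-elim (f≢y i e)
    φ-inj (suc (suc (suc i))) (suc (suc zero)) e = ⊥-elim (edge-≢ G (zf i) (sym e))
    φ-inj (suc (suc (suc i))) (suc (suc (suc j))) e = cong (λ t → suc (suc (suc t))) (f-inj e)
    arc-edge : ∀ {a b} → Arc a b → Edge G (φ a) (φ b)
    arc-edge handle      = xy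
    arc-edge neck        = yz
    arc-edge (bristle i) = zf i
    hom : ∀ a b → Edge (broom (2 + l)) a b → Edge G (φ a) (φ b)
    hom a b e with arc a b e
    ... | inj₁ ab = arc-edge ab
    ... | inj₂ ba = edge-sym G (arc-edge ba)
    arc-rainbow : ∀ {a b a′ b′} → Arc a b → Arc a′ b′ → c (φ a) (φ b) ≡ c (φ a′) (φ b′) →
      a ≡ a′ × b ≡ b′
    arc-rainbow handle handle _ = refl , refl
    arc-rainbow handle neck e = ⊥-elim (x≢z (c-inj yx yz (trans (c-sym yx) e)))
    arc-rainbow handle (bristle j) e = ⊥-elim (fc j (sym e))
    arc-rainbow neck handle e = ⊥-elim (x≢z (c-inj yx yz (trans (c-sym yx) (sym e))))
    arc-rainbow neck neck _ = refl , refl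
    arc-rainbow neck (bristle j) e = ⊥-elim (f≢y j (sym (c-inj zy (zf j) (trans (c-sym zy) e))))
    arc-rainbow (bristle i) handle e = ⊥-elim (fc i e)
    arc-rainbow (bristle i) neck e = ⊥-elim (f≢y i (sym (c-inj zy (zf i) (trans (c-sym zy) (sym e)))))
    arc-rainbow (bristle i) (bristle j) e with f-inj (c-inj (zf i) (zf j) e)
    ... | refl = refl , refl
    rainbow : ∀ a b a′ b′ → Edge (broom (2 + l)) a b → Edge (broom (2 + l)) a′ b′ →
      c (φ a) (φ b) ≡ c (φ a′) (φ b′) → (a ≡ a′ × b ≡ b′) ⊎ (a ≡ b′ × b ≡ a′)
    rainbow a b a′ b′ e e′ eq with arc a b e | arc a′ b′ e′
    ... | inj₁ α | inj₁ β = inj₁ (arc-rainbow α β eq)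
    ... | inj₁ α | inj₂ β = inj₂ (arc-rainbow α β (trans eq (sym (c-sym (arc-edge β)))))
    ... | inj₂ α | inj₁ β with arc-rainbow α β (trans (c-sym (arc-edge α)) eq)
    ...   | p , q = inj₂ (q , p)
    rainbow a b a′ b′ e e′ eq | inj₂ α | inj₂ β
      with arc-rainbow α β (trans (c-sym (arc-edge α)) (trans eq (sym (c-sym (arc-edge β)))))
    ...   | p , q = inj₁ (q , p)

  -- A bristle may be any neighbour of z other than x and y whose edge avoids the colour of xy.
  bristles : Fin n → Fin n → Fin n → Fin n → Bool
  bristles x y z j = adj G z j ∧ (not (j == x) ∧ (not (j == y) ∧ not (c z j ≡ᵇ c x y)))

  broomCopy-count : ∀ {l} x y z → Edge G z y → Edge G y x → x ≢ z → l ≤ count (bristles x y z) →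
    RainbowCopy G c (broom (2 + l))
  broomCopy-count x y z zy yx x≢z l≤ with choose _ (bristles x y z) l≤
  ... | f , f-inj , good = broomCopy x y z zy yx x≢z f f-inj
      (λ i → proj₁ (parts i))
      (λ i e → not-T (proj₁ (proj₂ (parts i))) (==-T e))
      (λ i e → not-T (proj₁ (proj₂ (proj₂ (parts i)))) (==-T e))
      (λ i e → not-T (proj₂ (proj₂ (proj₂ (parts i)))) (≡⇒≡ᵇ _ _ e))
    where
    parts : ∀ i → T (adj G z (f i)) × T (not (f i == x)) × T (not (f i == y)) × T (not (c z (f i) ≡ᵇ c x y))
    parts i with T-∧⁻ {adj G z (f i)} (good i)
    ... | p , t with T-∧⁻ {not (f i == x)} t
    ... | p′ , t′ = p , p′ , T-∧⁻ t′

  sameColour : Fin n → Fin n → Fin n → Fin n → Bool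
  sameColour x y z j = adj G z j ∧ (c z j ≡ᵇ c x y)

  count-sameColour≤1 : ∀ x y z → count (sameColour x y z) ≤ 1
  count-sameColour≤1 x y z = count≤1 (sameColour x y z) unique
    where
    unique : ∀ i j → T (sameColour x y z i) → T (sameColour x y z j) → i ≡ j
    unique i j Pi Pj with T-∧⁻ {adj G z i} Pi | T-∧⁻ {adj G z j} Pj
    ... | e , p | e′ , q = c-inj e e′ (trans (≡ᵇ⇒≡ _ _ p) (sym (≡ᵇ⇒≡ _ _ q)))

  -- Of the neighbours of z, only x, y and the one along the colour of xy fail to be bristles.
  degree≤bristles : ∀ x y z →
    degree G z ≤ count (bristles x y z) + (ind (adj G z x) + (1 + count (sameColour x y z)))
  degree≤bristles x y z = begin
    degree G z
      ≤⟨ sum-mono pointwise ⟩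
    sum (λ j → ind (bristles x y z j) + (ind (j == x) * ind (adj G z x) + (ind (j == y) + ind (sameColour x y z j))))
      ≡⟨ ∑-distrib-+ (ind ∘ bristles x y z) _ ⟩
    count (bristles x y z) + sum (λ j → ind (j == x) * ind (adj G z x) + (ind (j == y) + ind (sameColour x y z j)))
      ≡⟨ cong (count (bristles x y z) +_) (trans (∑-distrib-+ (λ j → ind (j == x) * ind (adj G z x)) _)
          (cong₂ _+_ (sum-δ x (λ _ → ind (adj G z x)))
            (trans (∑-distrib-+ (λ j → ind (j == y)) (ind ∘ sameColour x y z))
                   (cong (_+ count (sameColour x y z)) (count-== y))))) ⟩
    count (bristles x y z) + (ind (adj G z x) + (1 + count (sameColour x y z))) ∎
    where
    open ≤-Reasoning
    pointwise : ∀ j → ind (adj G z j) ≤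
      ind (bristles x y z j) + (ind (j == x) * ind (adj G z x) + (ind (j == y) + ind (sameColour x y z j)))
    pointwise j with j Fin.≟ x
    pointwise j | yes refl = ≤-trans (≤-reflexive (sym (*-identityˡ _))) (≤-trans (m≤m+n _ _) (m≤n+m _ (ind (adj G z j ∧ false))))
    pointwise j | no _ with adj G z j | j == y | c z j ≡ᵇ c x y
    ... | false | _     | _     = z≤n
    ... | true  | true  | _     = s≤s z≤n
    ... | true  | false | true  = s≤s z≤n
    ... | true  | false | false = s≤s z≤n

-- `σ` exchanges the points with `v < σ v` and those with `σ v < v`, and without fixed points there
-- are no others.
involution-even : ∀ {n} (σ : Fin n → Fin n) → (∀ v → σ (σ v) ≡ v) → (∀ v → σ v ≢ v) →
  ∃ λ s → 2 * s ≡ n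
involution-even {n} σ invol noFix = s , (begin
  2 * s                                   ≡⟨ cong (s +_) (+-identityʳ s) ⟩
  s + s                                   ≡⟨ cong (s +_) (sum-permute (ind ∘ up) (permutation σ σ invol invol)) ⟩
  s + sum (λ v → ind (up (σ v)))          ≡⟨ ∑-distrib-+ (ind ∘ up) (ind ∘ up ∘ σ) ⟨
  sum (λ v → ind (up v) + ind (up (σ v))) ≡⟨ sum-cong-≗ one ⟩
  sum {n} (λ _ → 1)                       ≡⟨ trans (sum-const n 1) (*-identityʳ n) ⟩
  n                                       ∎)
  where
  open ≡-Reasoning
  up : Fin n → Bool
  up v = does (v Fin.<? σ v)
  s = count up
  one : ∀ v → ind (up v) + ind (up (σ v)) ≡ 1
  one v rewrite invol v with Fin.<-cmp v (σ v)
  ... | tri< a _ ¬b rewrite dec-true (v Fin.<? σ v) a | dec-false (σ v Fin.<? v) ¬b = refl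
  ... | tri≈ _ e _ = ⊥-elim (noFix v (sym e))
  ... | tri> ¬a _ b rewrite dec-false (v Fin.<? σ v) ¬a | dec-true (σ v Fin.<? v) b = refl

module _ {n l} (G : Graph n) (c : Colouring n) (proper : Proper G c)
         (free : RainbowFree G c (broom (2 + l))) where

  -- Freeness leaves fewer than `l` bristles for the handle `x`, `y`, `z`; all other neighbours of
  -- `z` are accounted for by `degree≤bristles`.
  degree-bound : ∀ x y z → Edge G z y → Edge G y x → x ≢ z →
    suc (degree G z) ≤ l + (ind (adj G z x) + (1 + count (sameColour G c proper x y z)))
  degree-bound x y z zy yx x≢z = ≤-trans (s≤s (degree≤bristles G c proper x y z)) (+-monoˡ-≤ _ few)
    where
    few : count (bristles G c proper x y z) < l
    few = ≰⇒> (λ l≤ → free (broomCopy-count G c proper x y z zy yx x≢z l≤))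

  -- A handle costs `z` at most three neighbours, so degree k + 1 would leave the k - 2 bristles
  -- that complete a rainbow broom.
  star : ∀ z → 3 + l ≤ degree G z → ∀ {y x} → Edge G z y → Edge G y x → x ≡ z
  star z big {y} {x} zy yx with x Fin.≟ z
  ... | yes x≡z = x≡z
  ... | no x≢z = ⊥-elim (<-irrefl refl (begin-strict
    3 + l            ≤⟨ big ⟩
    degree G z       <⟨ degree-bound x y z zy yx x≢z ⟩
    l + (ind (adj G z x) + (1 + count (sameColour G c proper x y z)))
      ≤⟨ +-monoʳ-≤ l (+-mono-≤ (ind≤1 (adj G z x)) (s≤s (count-sameColour≤1 G c proper x y z))) ⟩
    l + 3            ≡⟨ +-comm l 3 ⟩
    3 + l            ∎))
    where open ≤-Reasoning

  -- With degree exactly k all three losses must really occur: `x` is a neighbour of `z`, and the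
  -- colour of `xy` is seen at `z`. Both terms of `both` are at most 1, so their sum being at least
  -- 2 forces each.
  enclosed : ∀ z → degree G z ≡ 2 + l → ∀ {y x} → Edge G z y → Edge G y x → x ≢ z →
    Edge G z x × ∃ λ w → Edge G z w × c z w ≡ c x y
  enclosed z deg {y} {x} zy yx x≢z = T-ind (m+n≰1ˡ both (count-sameColour≤1 G c proper x y z)) , colour
    where
    N = count (sameColour G c proper x y z)
    both : 2 ≤ ind (adj G z x) + N
    both = s≤s⁻¹ (+-cancelˡ-≤ l _ _ (begin
      l + 3                           ≡⟨ +-comm l 3 ⟩
      3 + l                           ≡⟨ cong suc deg ⟨
      suc (degree G z)                ≤⟨ degree-bound x y z zy yx x≢z ⟩
      l + (ind (adj G z x) + (1 + N)) ≡⟨ cong (l +_) (+-suc (ind (adj G z x)) N) ⟩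
      l + suc (ind (adj G z x) + N)   ∎))
      where open ≤-Reasoning
    m+n≰1ˡ : ∀ {a b} → 2 ≤ a + b → b ≤ 1 → a ≢ 0
    m+n≰1ˡ 2≤ b≤1 refl = <⇒≱ 2≤ b≤1
    colour : ∃ λ w → Edge G z w × c z w ≡ c x y
    colour with witness (sameColour G c proper x y z)
                  (m+n≰1ˡ (subst (2 ≤_) (+-comm (ind (adj G z x)) N) both) (ind≤1 (adj G z x)))
    ... | w , p with T-∧⁻ {adj G z w} p
    ... | e , q = w , e , ≡ᵇ⇒≡ _ _ q

-- By properness the mate along `α` is unique, so passing to the mate is an involution without fixed
-- points.
perfectMatching-even : ∀ {n} (G : Graph n) (c : Colouring n) → Proper G c → ∀ α →
  (∀ v → ∃ λ b → Edge G v b × c v b ≡ α) → ∃ λ s → 2 * s ≡ n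
perfectMatching-even G c proper α mate = involution-even partner partner-invol partner≢
  where
  partner = λ v → proj₁ (mate v)
  partner-edge : ∀ v → Edge G v (partner v)
  partner-edge v = proj₁ (proj₂ (mate v))
  partner-colour : ∀ v → c v (partner v) ≡ α
  partner-colour v = proj₂ (proj₂ (mate v))
  partner-invol : ∀ v → partner (partner v) ≡ v
  partner-invol v = c-inj G c proper (partner-edge (partner v)) (edge-sym G (partner-edge v))
    (trans (partner-colour (partner v))
      (trans (sym (partner-colour v)) (c-sym G c proper (partner-edge v))))
  partner≢ : ∀ v → partner v ≢ v
  partner≢ v e = edge-≢ G (partner-edge v) (sym e)

-- Degree sums of the components on k + 1 vertices

module _ {k} (H : Graph (suc k)) (c : Colouring (suc k)) (proper : Proper H c)
         (centre : ∀ i → Edge H zero (suc i))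
         (colours : ∀ a b → Edge H a b → ∃ λ i → c zero (suc i) ≡ c a b) where

  -- The incidence matrix of vertices and colours, with entries 0 and 1 by properness. Its rows add
  -- up to degrees and its columns to colour classes.
  present : Fin (suc k) → Fin k → ℕ
  present v i = count (λ b → adj H v b ∧ (c v b ≡ᵇ c zero (suc i)))

  present≤1 : ∀ v i → present v i ≤ 1
  present≤1 v i = count≤1 _ unique
    where
    unique : ∀ b b′ → T (adj H v b ∧ (c v b ≡ᵇ c zero (suc i))) →
      T (adj H v b′ ∧ (c v b′ ≡ᵇ c zero (suc i))) → b ≡ b′
    unique b b′ p p′ with T-∧⁻ {adj H v b} p | T-∧⁻ {adj H v b′} p′
    ... | e , q | e′ , q′ = c-inj H c proper e e′ (trans (≡ᵇ⇒≡ _ _ q) (sym (≡ᵇ⇒≡ _ _ q′)))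

  present-witness : ∀ v i → present v i ≢ 0 → ∃ λ b → Edge H v b × c v b ≡ c zero (suc i)
  present-witness v i ≢0 with witness _ ≢0
  ... | b , p with T-∧⁻ {adj H v b} p
  ... | e , q = b , e , ≡ᵇ⇒≡ _ _ q

  present-intro : ∀ v i b → Edge H v b → c v b ≡ c zero (suc i) → present v i ≢ 0
  present-intro v i b e q p≡0 = 1+n≰n (≤-trans (≤-reflexive (sym (count-== b)))
    (≤-trans (sum-mono (λ j → ind-mono (sub j))) (≤-reflexive p≡0)))
    where
    sub : ∀ j → T (j == b) → T (adj H v j ∧ (c v j ≡ᵇ c zero (suc i)))
    sub j t with T-== {i = j} t
    ... | refl = T-∧⁺ e (≡⇒≡ᵇ _ _ q)

  -- The colour of each edge occurs at the centre by `colours`, and only once there because the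
  -- colouring is proper.
  degree-present : ∀ v → degree H v ≡ sum (present v)
  degree-present v = sym (trans
    (∑-comm (λ i b → ind (adj H v b ∧ (c v b ≡ᵇ c zero (suc i)))))
    (sum-cong-≗ exactlyOne))
    where
    exactlyOne : ∀ b → sum (λ i → ind (adj H v b ∧ (c v b ≡ᵇ c zero (suc i)))) ≡ ind (adj H v b)
    exactlyOne b with adj H v b in eq
    ... | false = sum-≡0 {k} (λ _ → refl)
    ... | true with colours v b (subst T (sym eq) tt)
    ...   | i₀ , e = trans (sum-cong-≗ same) (count-== i₀)
      where
      same : ∀ i → ind (c v b ≡ᵇ c zero (suc i)) ≡ ind (i == i₀)
      same i with i Fin.≟ i₀
      ... | yes refl = ind-T (≡⇒≡ᵇ _ _ (sym e))
      ... | no i≢ = ind-¬T (λ t → i≢ (Fin.suc-injective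
              (c-inj H c proper (centre i) (centre i₀) (trans (sym (≡ᵇ⇒≡ _ _ t)) (sym e)))))

  -- This is the number of vertices that the colour covers, twice the number of its edges.
  colourClass : Fin k → ℕ
  colourClass i = sum (λ v → present v i)

  degreeSum-colourClass : degreeSum H ≡ sum colourClass
  degreeSum-colourClass = trans (sum-cong-≗ degree-present) (∑-comm present)

  -- A colour seen at all k + 1 vertices would be a perfect matching on an odd number of vertices.
  missed : ∀ {j} → k ≡ 2 * j → ∀ i → ∃ λ v → present v i ≡ 0
  missed {j} k≡2j i with Fin.any? (λ v → present v i ≟ 0)
  ... | yes found = found
  ... | no ∄ = ⊥-elim (odd-order (perfectMatching-even H c proper (c zero (suc i))
                 (λ v → present-witness v i (λ e → ∄ (v , e)))))
    where
    odd-order : ¬ ∃ λ s → 2 * s ≡ suc k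
    odd-order (s , 2s≡) = even≢odd s j (trans 2s≡ (cong suc k≡2j))

  colourClass≤k : ∀ {j} → k ≡ 2 * j → ∀ i → colourClass i ≤ k
  colourClass≤k {j} k≡2j i with missed {j} k≡2j i
  ... | v , v-misses = s≤s⁻¹ (≤-trans
    (sum-strict 1 (λ w → present≤1 w i) v (≤-reflexive (cong suc v-misses)))
    (≤-reflexive (*-identityʳ (suc k))))

  degreeSum≤k² : ∀ {j} → k ≡ 2 * j → degreeSum H ≤ k * k
  degreeSum≤k² {j} k≡2j = begin
    degreeSum H        ≡⟨ degreeSum-colourClass ⟩
    sum colourClass    ≤⟨ sum-mono (colourClass≤k {j} k≡2j) ⟩
    sum {k} (λ _ → k)  ≡⟨ sum-const k k ⟩
    k * k              ∎
    where open ≤-Reasoning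

nbhd-gap : ∀ {n} (G : Graph n) v → suc (degree G v) < n → ∃ λ x → x ≢ v × ¬ Edge G v x
nbhd-gap {n} G v small with Fin.any? (λ x → T? (not (nbhd G v x)))
... | yes (x , x∉) = x , (λ e → not-T x∉ (T-∨ˡ (==-T e))) , λ e → not-T x∉ (T-∨ʳ {x == v} e)
... | no ∄ = ⊥-elim (<-irrefl (sym full) small)
  where
  full : n ≡ suc (degree G v)
  full = begin
    n                 ≡⟨ trans (sum-const n 1) (*-identityʳ n) ⟨
    sum {n} (λ _ → 1) ≡⟨ sum-cong-≗ (λ x → sym (ind-T (dec x))) ⟩
    count (nbhd G v)  ≡⟨ count-nbhd G v ⟩
    suc (degree G v)  ∎
    where
    open ≡-Reasoning
    dec : ∀ x → T (nbhd G v x)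
    dec x with T? (nbhd G v x)
    ... | yes t = t
    ... | no ¬t = ⊥-elim (∄ (x , T-not ¬t))

nonNeighbour-degree : ∀ {n} (G : Graph n) v x → x ≢ v → ¬ Edge G v x → suc (degree G v) < n
nonNeighbour-degree {n} G v x x≢v ¬vx = begin-strict
  suc (degree G v) ≡⟨ count-nbhd G v ⟨
  count (nbhd G v) <⟨ sum-strict 1 (λ w → ind≤1 _) x (≤-reflexive (cong suc (ind-¬T x∉))) ⟩
  n * 1            ≡⟨ *-identityʳ n ⟩
  n                ∎
  where
  open ≤-Reasoning
  x∉ : ¬ T (nbhd G v x)
  x∉ t with T-∨⁻ {x == v} t
  ... | inj₁ e = x≢v (T-== e)
  ... | inj₂ e = ¬vx e

nonNeighbours-degree : ∀ {n} (G : Graph n) v x y → x ≢ v → ¬ Edge G v x → y ≢ v → ¬ Edge G v y → x ≢ y →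
  2 + degree G v < n
nonNeighbours-degree {n} G v x y x≢v ¬vx y≢v ¬vy x≢y = begin-strict
  2 + degree G v         ≡⟨ cong suc (count-nbhd G v) ⟨
  suc (count (nbhd G v)) <⟨ sum-strict₂ 1 (λ w → ind≤1 _) x y x≢y (out x x≢v ¬vx) (out y y≢v ¬vy) ⟩
  n * 1                  ≡⟨ *-identityʳ n ⟩
  n                      ∎
  where
  open ≤-Reasoning
  ∉N : ∀ x → x ≢ v → ¬ Edge G v x → ¬ T (nbhd G v x)
  ∉N x x≢v ¬vx t with T-∨⁻ {x == v} t
  ... | inj₁ e = x≢v (T-== e)
  ... | inj₂ e = ¬vx e
  out : ∀ x → x ≢ v → ¬ Edge G v x → ind (nbhd G v x) < 1
  out x x≢v ¬vx = ≤-reflexive (cong suc (ind-¬T (∉N x x≢v ¬vx)))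

-- For k = 4 the bound k² = 16 is not attained: equality would mean that every colour is missed
-- exactly once, so that no vertex can have degree 3, and five vertices cannot realise this.
module _ (H : Graph 5) (c : Colouring 5) (proper : Proper H c)
         (centre : ∀ i → Edge H zero (suc i))
         (colours : ∀ a b → Edge H a b → ∃ λ i → c zero (suc i) ≡ c a b)
         (free : RainbowFree H c (broom 4)) (large : 15 < degreeSum H) where

  private
    present′ = present H c proper centre colours
    class = colourClass H c proper centre colours
    class≤4 : ∀ i → class i ≤ 4
    class≤4 = colourClass≤k H c proper centre colours {2} refl
    degree-present′ = degree-present H c proper centre colours

  -- Four classes of at most 4 vertices must all be full to exceed 15, and a colour missed twice
  -- covers at most 3 of the 5 vertices.
  missed-once : ∀ i v x → v ≢ x → present′ v i ≡ 0 → present′ x i ≢ 0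
  missed-once i v x v≢x v-misses x-misses = <⇒≱ large (begin
    degreeSum H ≡⟨ degreeSum-colourClass H c proper centre colours ⟩
    sum class   ≤⟨ s≤s⁻¹ (sum-strict 4 class≤4 i class<4) ⟩
    15          ∎)
    where
    open ≤-Reasoning
    class<4 : class i < 4
    class<4 = s≤s⁻¹ (sum-strict₂ 1 (λ w → present≤1 H c proper centre colours w i) v x v≢x
      (≤-reflexive (cong suc v-misses)) (≤-reflexive (cong suc x-misses)))

  -- Such a `v` misses a colour `i` and has a single non-neighbour `x`. By `missed-once` some edge
  -- `xy` has colour `i`, and `y` is a neighbour of `v`. The handle `x`, `y`, `v` then leaves two
  -- bristles, unless colour `i` also occurs at `v`, which it does not.
  degree≢3 : ∀ v → degree H v ≢ 3
  degree≢3 v deg3 with Fin.any? (λ i → present′ v i ≟ 0)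
  ... | no ∄ = 1+n≰n (begin
      4                     ≤⟨ sum-mono {4} {λ _ → 1} (λ i → n≢0⇒n>0 (λ e → ∄ (i , e))) ⟩
      sum (present′ v)      ≡⟨ degree-present′ v ⟨
      degree H v            ≡⟨ deg3 ⟩
      3                     ∎)
    where open ≤-Reasoning
  ... | yes (i , v-misses) = contra (nbhd-gap H v (subst (λ d → suc d < 5) (sym deg3) ≤-refl))
    where
    contra : ¬ ∃ λ x → x ≢ v × ¬ Edge H v x
    contra (x , x≢v , ¬vx) = v-has (present-witness H c proper centre colours x i
                                     (missed-once i v x (λ e → x≢v (sym e)) v-misses))
      where
      v-has : ¬ ∃ λ y → Edge H x y × c x y ≡ c zero (suc i)
      v-has (y , xy , αi) with T? (adj H v y)
      ... | no ¬vy = <⇒≱ (nonNeighbours-degree H v x y x≢v ¬vx y≢v ¬vy (edge-≢ H xy))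
                         (≤-reflexive (sym (cong (2 +_) deg3)))
        where
        y≢v : y ≢ v
        y≢v refl = ¬vx (edge-sym H xy)
      ... | yes vy = repeated (count (sameColour H c proper x y v)) refl
        where
        repeated : ∀ N → N ≢ count (sameColour H c proper x y v)
        repeated zero 0≡ = <⇒≱ ≤-refl (begin
          4 ≡⟨ cong suc deg3 ⟨
          suc (degree H v) ≤⟨ degree-bound H c proper free x y v vy (edge-sym H xy) x≢v ⟩
          2 + (ind (adj H v x) + (1 + count (sameColour H c proper x y v)))
            ≡⟨ cong₂ (λ a b → 2 + (a + (1 + b))) (ind-¬T ¬vx) (sym 0≡) ⟩
          3 ∎)
          where open ≤-Reasoning
        repeated (suc N) N≡ with witness (sameColour H c proper x y v) (λ e → 1+n≢0 (trans N≡ e))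
        ... | w , t with T-∧⁻ {adj H v w} t
        ...   | vw , q = present-intro H c proper centre colours v i w vw (trans (≡ᵇ⇒≡ _ _ q) αi) v-misses

  degree≤4 : ∀ v → degree H v ≤ 4
  degree≤4 v = ≤-trans (≤-reflexive (degree-present′ v))
    (sum-mono {4} {present′ v} (present≤1 H c proper centre colours v))

  private
    -- Since degree 3 is excluded, every vertex of degree below 4 is bad.
    bad : Fin 5 → Bool
    bad v = degree H v ≤ᵇ 2

    degree+bad : ∀ v → degree H v + 2 * ind (bad v) ≤ 4
    degree+bad v with degree H v ≤ᵇ 2 in eq
    ... | true  = +-monoˡ-≤ 2 (≤ᵇ⇒≤ _ _ (subst T (sym eq) tt))
    ... | false = ≤-trans (≤-reflexive (+-identityʳ _)) (degree≤4 v)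

    -- A bad vertex falls short of degree 4 by at least 2, while all degrees together fall short of
    -- 20 by at most 4.
    bad≤2 : count bad ≤ 2
    bad≤2 = *-cancelˡ-≤ 2 (+-cancelˡ-≤ 16 _ _ (begin
      16 + 2 * count bad                            ≤⟨ +-monoˡ-≤ _ large ⟩
      degreeSum H + 2 * count bad                   ≡⟨ cong (degreeSum H +_) (*-distribˡ-sum 2 (ind ∘ bad)) ⟩
      degreeSum H + sum (λ v → 2 * ind (bad v))     ≡⟨ ∑-distrib-+ (degree H) (λ v → 2 * ind (bad v)) ⟨
      sum (λ v → degree H v + 2 * ind (bad v))      ≤⟨ sum-mono degree+bad ⟩
      20                                            ∎))
      where open ≤-Reasoning

    <4⇒bad : ∀ v → degree H v < 4 → T (bad v)
    <4⇒bad v d<4 = ≤⇒≤ᵇ (s≤s⁻¹ (≤∧≢⇒< (s≤s⁻¹ d<4) (degree≢3 v)))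

    nonAdjacent-bad : ∀ v → degree H v < 4 → ∀ x → T (not (adj H v x)) → T (bad x)
    nonAdjacent-bad v d<4 x t with x Fin.≟ v
    ... | yes refl = <4⇒bad x d<4
    ... | no x≢v   = <4⇒bad x (s≤s⁻¹ (nonNeighbour-degree H x v (λ e → x≢v (sym e)) (λ e → not-T t (edge-sym H e))))

    -- A vertex of degree below 4 has degree at most 2. It and its non-neighbours are then at least
    -- three vertices, all of degree below 4 and hence bad.
    noBad : ∀ v → 4 ≤ degree H v
    noBad v = ≮⇒≥ (λ d<4 → <⇒≱ (s≤s bad≤2) (three d<4))
      where
      three : degree H v < 4 → 3 ≤ count bad
      three d<4 = +-cancelˡ-≤ 2 _ _ (begin
        5                                                      ≡⟨⟩
        sum {5} (λ _ → 1)                                      ≡⟨ sum-cong-≗ (λ x → lem (adj H v x)) ⟩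
        sum (λ x → ind (adj H v x) + ind (not (adj H v x)))    ≡⟨ ∑-distrib-+ (ind ∘ adj H v) (λ x → ind (not (adj H v x))) ⟩
        degree H v + count (λ x → not (adj H v x))
          ≤⟨ +-mono-≤ (≤ᵇ⇒≤ (degree H v) 2 (<4⇒bad v d<4)) (sum-mono (λ x → ind-mono (nonAdjacent-bad v d<4 x))) ⟩
        2 + count bad                                          ∎)
        where
        open ≤-Reasoning
        lem : ∀ b → 1 ≡ ind b + ind (not b)
        lem true = refl
        lem false = refl

  degreeSum≰15 : ⊥
  degreeSum≰15 = <⇒≱ (≤ᵇ⇒≤ 17 20 tt) (begin
    20 ≤⟨ sum-mono noBad ⟩
    degreeSum H ≤⟨ degreeSum≤k² H c proper centre colours {2} refl ⟩
    16 ∎)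
    where open ≤-Reasoning

-- From components to the upper bounds

module _ {m n} (G : Graph n) (c : Colouring n) (g : Fin m → Fin n) (g-inj : Injective _≡_ _≡_ g) where

  induced : Graph m
  induced = record
    { adj    = λ a b → adj G (g a) (g b)
    ; sym    = λ a b → Graph.sym G (g a) (g b)
    ; irrefl = λ a → irrefl G (g a)
    }

  pullback : Colouring m
  pullback a b = c (g a) (g b)

  induced-proper : Proper G c → Proper induced pullback
  induced-proper (c-symm , c-distinct) =
    (λ a b → c-symm (g a) (g b)) ,
    (λ a b b′ e e′ b≢b′ → c-distinct (g a) (g b) (g b′) e e′ (λ eq → b≢b′ (g-inj eq)))

  induced-free : ∀ {p} (F : Graph p) → RainbowFree G c F → RainbowFree induced pullback F
  induced-free F free (φ , φ-inj , hom , rainbow) =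
    free (g ∘ φ , (λ e → φ-inj (g-inj e)) , hom , rainbow)

-- The interface between the structure around a vertex of degree k and the counting on its
-- component: `zero` is that vertex, and the condition on colours is what `enclosed` provides.
ComponentBound : ℕ → ℕ → Set
ComponentBound k B = ∀ (H : Graph (suc k)) (c : Colouring (suc k)) → Proper H c →
  RainbowFree H c (broom k) → (∀ i → Edge H zero (suc i)) →
  (∀ a b → Edge H a b → ∃ λ i → c zero (suc i) ≡ c a b) → degreeSum H ≤ B

degree-≤ : ∀ {n} (G : Graph (suc n)) v → degree G v ≤ n
degree-≤ {n} G v = s≤s⁻¹ (begin
  suc (degree G v)          ≡⟨ count-nbhd G v ⟨
  count (nbhd G v)          ≤⟨ sum-mono {suc n} (λ w → ind≤1 (nbhd G v w)) ⟩
  sum {suc n} (λ _ → 1)     ≡⟨ trans (sum-const (suc n) 1) (*-identityʳ (suc n)) ⟩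
  suc n                     ∎)
  where open ≤-Reasoning

componentBound-trivial : ∀ k → ComponentBound k (suc k * k)
componentBound-trivial k H c _ _ _ _ =
  ≤-trans (sum-mono {suc k} (degree-≤ H)) (≤-reflexive (sum-const (suc k) k))

componentBound-even : ∀ k j → k ≡ 2 * j → ComponentBound k (k * k)
componentBound-even k j k≡2j H c proper _ centre colours = degreeSum≤k² H c proper centre colours {j} k≡2j

componentBound-4 : ComponentBound 4 15
componentBound-4 H c proper free centre colours =
  ≮⇒≥ (λ large → degreeSum≰15 H c proper centre colours free large)

module _ {n l} (G : Graph n) (c : Colouring n) (proper : Proper G c)
         (free : RainbowFree G c (broom (2 + l))) (p q : ℕ) where

  -- A star with d leaves has degree sum 2d on d + 1 vertices, so its average stays below 2.
  heavy-star : 2 * q ≤ p → ∀ z → 3 + l ≤ degree G z → Heavy G p q z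
  heavy-star 2q≤p z big = closed , (begin
    q * degreesOver G (nbhd G z)               ≤⟨ *-monoʳ-≤ q (sum-mono pointwise) ⟩
    q * sum (λ v → ind (v == z) * degree G v + ind (adj G z v))
      ≡⟨ cong (q *_) (trans (∑-distrib-+ (λ v → ind (v == z) * degree G v) (ind ∘ adj G z))
                            (cong (_+ degree G z) (sum-δ z (degree G)))) ⟩
    q * (degree G z + degree G z)              ≡⟨ double q (degree G z) ⟩
    2 * q * degree G z                         ≤⟨ *-mono-≤ 2q≤p (n≤1+n (degree G z)) ⟩
    p * suc (degree G z)                       ≡⟨ cong (p *_) (count-nbhd G z) ⟨
    p * count (nbhd G z)                       ∎)
    where
    open ≤-Reasoning
    double : ∀ q d → q * (d + d) ≡ 2 * q * d
    double = solve-∀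
    closed : Closed G (nbhd G z)
    closed v w v∈ vw with T-∨⁻ {v == z} v∈
    ... | inj₁ e = T-∨ʳ {w == z} (subst (λ u → Edge G u w) (T-== e) vw)
    ... | inj₂ zv = T-∨ˡ (==-T (star G c proper free z big zv vw))
    leaf : ∀ v → Edge G z v → degree G v ≤ 1
    leaf v zv = count≤1 (adj G v) (λ i j vi vj →
      trans (star G c proper free z big zv vi) (sym (star G c proper free z big zv vj)))
    pointwise : ∀ v → ind (nbhd G z v) * degree G v ≤ ind (v == z) * degree G v + ind (adj G z v)
    pointwise v with v Fin.≟ z
    ... | yes _ = m≤m+n _ _
    ... | no _ with adj G z v in eq
    ...   | true  = ≤-trans (≤-reflexive (*-identityˡ _)) (leaf v (subst T (sym eq) tt))
    ...   | false = z≤n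

  -- By `enclosed` no edge leaves the closed neighbourhood and every colour inside it occurs at `z`.
  -- Enumerating it with `z` at `zero` gives an instance of `ComponentBound`.
  heavy-component : ∀ B → ComponentBound (2 + l) B → q * B ≤ p * (3 + l) →
    ∀ z → degree G z ≡ 2 + l → Heavy G p q z
  heavy-component B bound qB≤ z deg = closed , (begin
    q * degreesOver G (nbhd G z)   ≤⟨ *-monoʳ-≤ q degrees≤B ⟩
    q * B                          ≤⟨ qB≤ ⟩
    p * (3 + l)                    ≡⟨ cong (p *_) (trans (count-nbhd G z) (cong suc deg)) ⟨
    p * count (nbhd G z)           ∎)
    where
    open ≤-Reasoning
    k = degree G z
    closed : Closed G (nbhd G z)
    closed v w v∈ vw with T-∨⁻ {v == z} v∈ | w Fin.≟ z
    ... | _      | yes _   = tt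
    ... | inj₁ e | no _    = subst (λ u → Edge G u w) (T-== e) vw
    ... | inj₂ zv | no w≢z = proj₁ (enclosed G c proper free z deg zv vw w≢z)
    enumeration = enumerate (adj G z)
    f : Fin k → Fin n
    f = proj₁ enumeration
    f-inj = proj₁ (proj₂ enumeration)
    zf : ∀ i → Edge G z (f i)
    zf = proj₁ (proj₂ (proj₂ enumeration))
    f-sur : ∀ v → Edge G z v → ∃ λ i → f i ≡ v
    f-sur = proj₂ (proj₂ (proj₂ enumeration))
    g : Fin (suc k) → Fin n
    g zero    = z
    g (suc i) = f i
    g-inj : ∀ a b → g a ≡ g b → a ≡ b
    g-inj zero    zero    _ = refl
    g-inj zero    (suc b) e = ⊥-elim (edge-≢ G (zf b) e)
    g-inj (suc a) zero    e = ⊥-elim (edge-≢ G (zf a) (sym e))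
    g-inj (suc a) (suc b) e = cong suc (f-inj e)
    g-sur : ∀ v → T (nbhd G z v) → ∃ λ a → g a ≡ v
    g-sur v v∈ with T-∨⁻ {v == z} v∈
    ... | inj₁ e = zero , sym (T-== e)
    ... | inj₂ zv with f-sur v zv
    ...   | i , e = suc i , e
    nbhd-g : ∀ a → T (nbhd G z (g a))
    nbhd-g zero    = nbhd-self G z
    nbhd-g (suc i) = T-∨ʳ {f i == z} (zf i)
    inj : Injective _≡_ _≡_ g
    inj {a} {b} = g-inj a b
    H : Graph (suc k)
    H = induced G c g inj
    at-centre : ∀ v → Edge G z v → ∃ λ i → c z (f i) ≡ c z v
    at-centre v zv with f-sur v zv
    ... | i , refl = i , refl
    colours : ∀ a b → Edge H a b → ∃ λ i → c z (f i) ≡ c (g a) (g b)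
    colours zero    b       e = at-centre (g b) e
    colours (suc a) zero    e with at-centre (f a) (zf a)
    ... | i , eq = i , trans eq (c-sym G c proper (zf a))
    colours (suc a) (suc b) e
      with enclosed G c proper free z deg (zf b) (edge-sym G e) (λ fa≡z → edge-≢ G (zf a) (sym fa≡z))
    ... | _ , w , zw , eq with at-centre w zw
    ...   | i , eq′ = i , trans eq′ eq
    -- No degree is lost in the induced graph, because the neighbourhood is closed.
    degree-H : ∀ a → degree G (g a) ≤ degree H a
    degree-H a = sum-image (λ w → ind (adj G (g a) w)) g (λ w ≢0 → g-sur w (closed (g a) w (nbhd-g a) (T-ind ≢0)))
    degrees≤B : degreesOver G (nbhd G z) ≤ B
    degrees≤B = begin
      degreesOver G (nbhd G z)
        ≤⟨ sum-image (λ v → ind (nbhd G z v) * degree G v) g covers ⟩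
      sum (λ a → ind (nbhd G z (g a)) * degree G (g a))
        ≤⟨ sum-mono (λ a → ≤-trans (*-monoˡ-≤ (degree G (g a)) (ind≤1 (nbhd G z (g a))))
                                   (≤-trans (≤-reflexive (*-identityˡ _)) (degree-H a))) ⟩
      degreeSum H
        ≤⟨ subst (λ d → ComponentBound d B) (sym deg) bound H (pullback G c g inj)
             (induced-proper G c g inj proper)
             (induced-free G c g inj (broom k) (subst (λ d → RainbowFree G c (broom d)) (sym deg) free))
             zf colours ⟩
      B ∎
      where
      covers : ∀ v → ind (nbhd G z v) * degree G v ≢ 0 → ∃ λ a → g a ≡ v
      covers v ≢0 with nbhd G z v in eq
      ... | true  = g-sur v (subst T (sym eq) tt)
      ... | false = ⊥-elim (≢0 refl)

  -- The numerical hypotheses say that `p / q` is at least 2, k - 1 and B/(k+1). These serve stars,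
  -- vertices of degree below k, and components around vertices of degree k, in this order.
  upper : ∀ B → 2 * q ≤ p → q * (1 + l) ≤ p → q * B ≤ p * (3 + l) → ComponentBound (2 + l) B →
    q * degreeSum G ≤ p * n
  upper B 2q≤p q[1+l]≤p qB≤ bound = degreeSum-bound G p q cases
    where
    cases : ∀ v → Light G p q v ⊎ Heavy G p q v
    cases v with <-cmp (degree G v) (2 + l)
    ... | tri< d<  _ _ = inj₁ (≤-trans (*-monoʳ-≤ q (s≤s⁻¹ d<)) q[1+l]≤p)
    ... | tri≈ _ d≡ _ = inj₂ (heavy-component B bound qB≤ v d≡)
    ... | tri> _ _ d> = inj₂ (heavy-star 2q≤p v d>)

-- The broom with k = 2 is a path with two edges, rainbow in every proper colouring. The target 1 is
-- below the 2 that `upper` requires, so this case is done directly.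
matching-degree : ∀ {n} (G : Graph n) (c : Colouring n) → Proper G c → RainbowFree G c (broom 2) →
  ∀ v → degree G v ≤ 1
matching-degree G c proper free v = ≮⇒≥ contra
  where
  contra : ¬ (2 ≤ degree G v)
  contra 2≤ with choose 2 (adj G v) 2≤
  ... | f , f-inj , vf = free (broomCopy G c proper (f zero) v (f (suc zero)) (edge-sym G (vf (suc zero)))
          (vf zero) (λ e → 0≢1 (f-inj e)) (λ ()) (λ {}) (λ ()) (λ ()) (λ ()) (λ ()))
    where
    0≢1 : zero ≢ suc {1} zero
    0≢1 ()

module _ {n k} (G : Graph n) (c : Colouring n) (proper : Proper G c) (free : RainbowFree G c (broom k)) where

  upper-odd : 2 ≤ k → 2 * edgeCount G ≤ k * n
  upper-odd (s≤s (s≤s {n = l} z≤n)) = begin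
    2 * edgeCount G     ≡⟨ trans (handshake G) (sym (*-identityˡ (degreeSum G))) ⟩
    1 * degreeSum G     ≤⟨ upper G c proper free (2 + l) 1 ((3 + l) * (2 + l)) (s≤s (s≤s z≤n))
                            (≤-trans (≤-reflexive (*-identityˡ _)) (n≤1+n _))
                            (≤-reflexive (trans (*-identityˡ _) (*-comm (3 + l) (2 + l))))
                            (componentBound-trivial (2 + l)) ⟩
    (2 + l) * n         ∎
    where open ≤-Reasoning

  upper-2-4 : k ≡ 2 ⊎ k ≡ 4 → 2 * edgeCount G ≤ (k ∸ 1) * n
  upper-2-4 (inj₁ refl) = begin
    2 * edgeCount G     ≡⟨ handshake G ⟩
    degreeSum G         ≤⟨ sum-mono (matching-degree G c proper free) ⟩
    sum {n} (λ _ → 1)   ≡⟨ trans (sum-const n 1) (*-comm n 1) ⟩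
    1 * n               ∎
    where open ≤-Reasoning
  upper-2-4 (inj₂ refl) = begin
    2 * edgeCount G     ≡⟨ trans (handshake G) (sym (*-identityˡ (degreeSum G))) ⟩
    1 * degreeSum G     ≤⟨ upper G c proper free 3 1 15 (≤ᵇ⇒≤ _ _ tt) ≤-refl ≤-refl componentBound-4 ⟩
    3 * n               ∎
    where open ≤-Reasoning

  upper-even : Even k → 6 ≤ k → 2 * (k + 1) * edgeCount G ≤ k * k * n
  upper-even (j , k≡2j) (s≤s (s≤s {n = l} 4≤l)) = begin
    2 * (k + 1) * edgeCount G   ≡⟨ rearrange k (edgeCount G) ⟩
    (1 + k) * (2 * edgeCount G) ≡⟨ cong ((1 + k) *_) (handshake G) ⟩
    (1 + k) * degreeSum G       ≤⟨ upper G c proper free (k * k) (1 + k) (k * k) two below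
                                     (≤-reflexive (*-comm (1 + k) (k * k))) (componentBound-even k j k≡2j) ⟩
    k * k * n                   ∎
    where
    open ≤-Reasoning
    rearrange : ∀ k e → 2 * (k + 1) * e ≡ (1 + k) * (2 * e)
    rearrange = solve-∀
    -- Degree k - 1 is just below the target: (k + 1)(k - 1) + 1 = k².
    below : (1 + k) * (1 + l) ≤ k * k
    below = ≤-trans (m≤m+n _ 1) (≤-reflexive (lem l))
      where
      lem : ∀ l → (3 + l) * (1 + l) + 1 ≡ (2 + l) * (2 + l)
      lem = solve-∀
    two : 2 * (1 + k) ≤ k * k
    two = ≤-trans (*-monoˡ-≤ (1 + k) (≤-trans (≤ᵇ⇒≤ 2 5 tt) (s≤s 4≤l))) (≤-trans (≤-reflexive (*-comm (1 + l) (1 + k))) below)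

-- Disjoint unions

module _ {m n} (G : Graph m) (H : Graph n) (c : Colouring m) (d : Colouring n) where

  Side : Set
  Side = Fin m ⊎ Fin n

  adj⊎ : Side → Side → Bool
  adj⊎ (inj₁ u) (inj₁ v) = adj G u v
  adj⊎ (inj₂ u) (inj₂ v) = adj H u v
  adj⊎ _        _        = false

  col⊎ : Side → Side → ℕ
  col⊎ (inj₁ u) (inj₁ v) = c u v
  col⊎ (inj₂ u) (inj₂ v) = d u v
  col⊎ _        _        = 0

  side : Fin (m + n) → Side
  side = Fin.splitAt m

  side-injective : ∀ {i j} → side i ≡ side j → i ≡ j
  side-injective {i} {j} e =
    trans (sym (Fin.join-splitAt m n i)) (trans (cong (Fin.join m n) e) (Fin.join-splitAt m n j))

  union : Graph (m + n)
  union = record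
    { adj    = λ i j → adj⊎ (side i) (side j)
    ; sym    = λ i j → adj⊎-sym (side i) (side j)
    ; irrefl = λ i → adj⊎-irrefl (side i)
    }
    where
    adj⊎-sym : ∀ u v → adj⊎ u v ≡ adj⊎ v u
    adj⊎-sym (inj₁ u) (inj₁ v) = Graph.sym G u v
    adj⊎-sym (inj₁ u) (inj₂ v) = refl
    adj⊎-sym (inj₂ u) (inj₁ v) = refl
    adj⊎-sym (inj₂ u) (inj₂ v) = Graph.sym H u v
    adj⊎-irrefl : ∀ u → adj⊎ u u ≡ false
    adj⊎-irrefl (inj₁ u) = irrefl G u
    adj⊎-irrefl (inj₂ u) = irrefl H u

  unionColouring : Colouring (m + n)
  unionColouring i j = col⊎ (side i) (side j)

  union-proper : Proper G c → Proper H d → Proper union unionColouring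
  union-proper (c-symm , c-distinct) (d-symm , d-distinct) =
    (λ i j → symm (side i) (side j)) ,
    (λ i j k e e′ j≢k → distinct (side i) (side j) (side k) e e′ (λ eq → j≢k (side-injective eq)))
    where
    symm : ∀ u v → T (adj⊎ u v) → col⊎ u v ≡ col⊎ v u
    symm (inj₁ u) (inj₁ v) = c-symm u v
    symm (inj₂ u) (inj₂ v) = d-symm u v
    distinct : ∀ u v w → T (adj⊎ u v) → T (adj⊎ u w) → v ≢ w → col⊎ u v ≢ col⊎ u w
    distinct (inj₁ u) (inj₁ v) (inj₁ w) e e′ v≢w = c-distinct u v w e e′ (v≢w ∘ cong inj₁)
    distinct (inj₂ u) (inj₂ v) (inj₂ w) e e′ v≢w = d-distinct u v w e e′ (v≢w ∘ cong inj₂)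

  -- The broom is connected: walking outwards from its centre never changes sides, so a copy lies
  -- within `G` or within `H`.
  union-free : ∀ {l} → RainbowFree G c (broom (2 + l)) → RainbowFree H d (broom (2 + l)) →
    RainbowFree union unionColouring (broom (2 + l))
  union-free {l} G-free H-free (φ , φ-inj , hom , rainbow) = oneSide (s (suc (suc zero))) refl
    where
    s : Fin (3 + l) → Side
    s a = side (φ a)
    spread : {P : Side → Set} → (∀ u v → T (adj⊎ u v) → P u → P v) → P (s (suc (suc zero))) → ∀ a → P (s a)
    spread step Pz zero                =
      step _ _ (hom (suc zero) zero tt) (step _ _ (hom (suc (suc zero)) (suc zero) tt) Pz)
    spread step Pz (suc zero)          = step _ _ (hom (suc (suc zero)) (suc zero) tt) Pz
    spread step Pz (suc (suc zero))    = Pz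
    spread step Pz (suc (suc (suc i))) = step _ _ (hom (suc (suc zero)) (suc (suc (suc i))) tt) Pz
    Within : ∀ {p} → (Fin p → Side) → Side → Set
    Within ι u = ∃ λ v → u ≡ ι v
    restrict : ∀ {p} (K : Graph p) (e : Colouring p) (ι : Fin p → Side) →
      (∀ u v → adj⊎ (ι u) (ι v) ≡ adj K u v) → (∀ u v → col⊎ (ι u) (ι v) ≡ e u v) →
      (∀ a → Within ι (s a)) → RainbowCopy K e (broom (2 + l))
    restrict K e ι adj≡ col≡ within = ψ , ψ-inj , ψ-hom , ψ-rainbow
      where
      ψ = λ a → proj₁ (within a)
      s≡ : ∀ a → s a ≡ ι (ψ a)
      s≡ a = proj₂ (within a)
      ψ-inj : Injective _≡_ _≡_ ψ
      ψ-inj {a} {b} eq = φ-inj (side-injective (trans (s≡ a) (trans (cong ι eq) (sym (s≡ b)))))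
      ψ-hom : ∀ a b → Edge (broom (2 + l)) a b → Edge K (ψ a) (ψ b)
      ψ-hom a b ab = subst T (trans (cong₂ adj⊎ (s≡ a) (s≡ b)) (adj≡ (ψ a) (ψ b))) (hom a b ab)
      colour : ∀ a b → e (ψ a) (ψ b) ≡ col⊎ (s a) (s b)
      colour a b = sym (trans (cong₂ col⊎ (s≡ a) (s≡ b)) (col≡ (ψ a) (ψ b)))
      ψ-rainbow : ∀ a b a′ b′ → Edge (broom (2 + l)) a b → Edge (broom (2 + l)) a′ b′ →
        e (ψ a) (ψ b) ≡ e (ψ a′) (ψ b′) → (a ≡ a′ × b ≡ b′) ⊎ (a ≡ b′ × b ≡ a′)
      ψ-rainbow a b a′ b′ ab ab′ eq =
        rainbow a b a′ b′ ab ab′ (trans (sym (colour a b)) (trans eq (colour a′ b′)))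
    oneSide : ∀ u → s (suc (suc zero)) ≡ u → ⊥
    oneSide (inj₁ u) eq = G-free (restrict G c inj₁ (λ _ _ → refl) (λ _ _ → refl)
      (spread step₁ (u , eq)))
      where
      step₁ : ∀ u v → T (adj⊎ u v) → Within inj₁ u → Within inj₁ v
      step₁ (inj₁ _) (inj₁ v) _ _ = v , refl
    oneSide (inj₂ u) eq = H-free (restrict H d inj₂ (λ _ _ → refl) (λ _ _ → refl)
      (spread step₂ (u , eq)))
      where
      step₂ : ∀ u v → T (adj⊎ u v) → Within inj₂ u → Within inj₂ v
      step₂ (inj₂ _) (inj₂ v) _ _ = v , refl

  degreeSum-union : degreeSum union ≡ degreeSum G + degreeSum H
  degreeSum-union = trans (sum-↑ m (degree union))
    (cong₂ _+_ (sum-cong-≗ degree-G) (sum-cong-≗ degree-H))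
    where
    degree-G : ∀ i → degree union (i Fin.↑ˡ n) ≡ degree G i
    degree-G i = trans (sum-↑ m (λ j → ind (adj union (i Fin.↑ˡ n) j)))
      (trans (cong₂ _+_ (sum-cong-≗ near) (sum-≡0 far)) (+-identityʳ (degree G i)))
      where
      near : ∀ j → ind (adj union (i Fin.↑ˡ n) (j Fin.↑ˡ n)) ≡ ind (adj G i j)
      near j rewrite Fin.splitAt-↑ˡ m i n | Fin.splitAt-↑ˡ m j n = refl
      far : ∀ j → ind (adj union (i Fin.↑ˡ n) (m Fin.↑ʳ j)) ≡ 0
      far j rewrite Fin.splitAt-↑ˡ m i n | Fin.splitAt-↑ʳ m n j = refl
    degree-H : ∀ i → degree union (m Fin.↑ʳ i) ≡ degree H i
    degree-H i = trans (sum-↑ m (λ j → ind (adj union (m Fin.↑ʳ i) j)))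
      (cong₂ _+_ (sum-≡0 far) (sum-cong-≗ near))
      where
      near : ∀ j → ind (adj union (m Fin.↑ʳ i) (m Fin.↑ʳ j)) ≡ ind (adj H i j)
      near j rewrite Fin.splitAt-↑ʳ m n i | Fin.splitAt-↑ʳ m n j = refl
      far : ∀ j → ind (adj union (m Fin.↑ʳ i) (j Fin.↑ˡ n)) ≡ 0
      far j rewrite Fin.splitAt-↑ʳ m n i | Fin.splitAt-↑ˡ m j n = refl

  edgeCount-union : edgeCount union ≡ edgeCount G + edgeCount H
  edgeCount-union = *-cancelˡ-≡ _ _ 2 (begin
    2 * edgeCount union                 ≡⟨ handshake union ⟩
    degreeSum union                     ≡⟨ degreeSum-union ⟩
    degreeSum G + degreeSum H           ≡⟨ cong₂ _+_ (handshake G) (handshake H) ⟨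
    2 * edgeCount G + 2 * edgeCount H   ≡⟨ *-distribˡ-+ 2 (edgeCount G) (edgeCount H) ⟨
    2 * (edgeCount G + edgeCount H)     ∎)
    where open ≡-Reasoning

admissible-union : ∀ {m n l e f} → Admissible m (broom (2 + l)) e → Admissible n (broom (2 + l)) f →
  Admissible (m + n) (broom (2 + l)) (e + f)
admissible-union (G , c , c-proper , G-free , e≡) (H , d , d-proper , H-free , f≡) =
  union G H c d , unionColouring G H c d , union-proper G H c d c-proper d-proper ,
  union-free G H c d G-free H-free , trans (edgeCount-union G H c d) (cong₂ _+_ e≡ f≡)

admissible-zero : ∀ n l → Admissible n (broom (2 + l)) 0
admissible-zero n l = empty , (λ _ _ → 0) , ((λ _ _ ()) , (λ _ _ _ ())) ,
  (λ (_ , _ , hom , _) → hom zero (suc zero) tt) ,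
  *-cancelˡ-≡ _ _ 2 (trans (handshake empty) (sum-≡0 {n} (λ i → sum-≡0 {n} (λ _ → refl))))
  where
  empty : Graph n
  empty = record { adj = λ _ _ → false ; sym = λ _ _ → refl ; irrefl = λ _ → refl }

admissible-copies : ∀ {K l e} → Admissible K (broom (2 + l)) e → ∀ r s →
  Admissible (s + r * K) (broom (2 + l)) (r * e)
admissible-copies {K} {l} base zero s =
  subst (λ n → Admissible n (broom (2 + l)) 0) (sym (+-identityʳ s)) (admissible-zero s l)
admissible-copies {K} {l} {e} base (suc r) s =
  subst (λ n → Admissible n (broom (2 + l)) (e + r * e)) (lem K s (r * K))
    (admissible-union base (admissible-copies base r s))
  where
  lem : ∀ K s t → K + (s + t) ≡ s + (K + t)
  lem = solve-∀

-- Take `n / K` copies of the base graph and `n % K` isolated vertices; the remainder costs at most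
-- `a * K`, which becomes the constant.
lower : ∀ {K l a b e} .{{_ : NonZero K}} → Admissible K (broom (2 + l)) e → a * K ≤ b * e →
  ∀ n → ∃ λ m → Admissible n (broom (2 + l)) m × a * n ≤ b * m + a * K
lower {K} {l} {a} {b} {e} base dense n =
  n / K * e ,
  subst (λ N → Admissible N (broom (2 + l)) (n / K * e)) (sym (m≡m%n+[m/n]*n n K))
    (admissible-copies base (n / K) (n % K)) ,
  (begin
    a * n                         ≡⟨ cong (a *_) (m≡m%n+[m/n]*n n K) ⟩
    a * (n % K + n / K * K)       ≡⟨ expand a (n % K) (n / K) K ⟩
    n / K * (a * K) + a * (n % K) ≤⟨ +-mono-≤ (*-monoʳ-≤ (n / K) dense) (*-monoʳ-≤ a (<⇒≤ (m%n<n n K))) ⟩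
    n / K * (b * e) + a * K       ≡⟨ cong (_+ a * K) (swap (n / K) b e) ⟩
    b * (n / K * e) + a * K       ∎)
  where
  open ≤-Reasoning
  expand : ∀ a s r K → a * (s + r * K) ≡ r * (a * K) + a * s
  expand = solve-∀
  swap : ∀ r b e → r * (b * e) ≡ b * (r * e)
  swap = solve-∀

-- Cliques

injective⇒surjective : ∀ {n} (f : Fin n → Fin n) → Injective _≡_ _≡_ f → ∀ w → ∃ λ a → f a ≡ w
injective⇒surjective {n} f f-inj w with Fin.any? (λ a → f a Fin.≟ w)
... | yes found = found
... | no ∄ = ⊥-elim (1+n≰n (Fin.injective⇒≤ (λ {a} {b} → g-inj a b)))
  where
  g : Fin (suc n) → Fin n
  g zero    = w
  g (suc a) = f a
  g-inj : ∀ a b → g a ≡ g b → a ≡ b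
  g-inj zero    zero    _ = refl
  g-inj zero    (suc b) e = ⊥-elim (∄ (b , sym e))
  g-inj (suc a) zero    e = ⊥-elim (∄ (a , e))
  g-inj (suc a) (suc b) e = cong suc (f-inj e)

-- A broom in a graph on k + 1 vertices is spanning and, with only k colours, uses all of them.
-- If zx were an edge then its colour would have to be repeated on xy, next to it.
fewColours-free : ∀ {l} (G : Graph (3 + l)) (c : Colouring (3 + l)) → Proper G c →
  (∀ u v → Edge G u v → c u v < 2 + l) →
  (∀ z x → z ≢ x → ¬ Edge G z x → ∃ λ x′ → x′ ≢ x × x′ ≢ z × ¬ Edge G z x′) →
  RainbowFree G c (broom (2 + l))
fewColours-free {l} G c proper few second (φ , φ-inj , hom , rainbow) with T? (adj G z x)
  where
  z = φ (suc (suc zero))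
  x = φ zero
... | no ¬zx = noSecond (second _ _ (λ e → 2≢0 (φ-inj e)) ¬zx)
  where
  2≢0 : suc (suc zero) ≢ zero {2 + l}
  2≢0 ()
  noSecond : ¬ ∃ λ x′ → x′ ≢ φ zero × x′ ≢ φ (suc (suc zero)) × ¬ Edge G (φ (suc (suc zero))) x′
  noSecond (x′ , ≢x , ≢z , ¬zx′) with injective⇒surjective φ φ-inj x′
  ... | zero , refl              = ≢x refl
  ... | suc zero , refl          = ¬zx′ (hom (suc (suc zero)) (suc zero) tt)
  ... | suc (suc zero) , refl    = ≢z refl
  ... | suc (suc (suc i)) , refl = ¬zx′ (hom (suc (suc zero)) (suc (suc (suc i))) tt)
... | yes zx = clash (Fin.pigeonhole ≤-refl (λ a → Fin.fromℕ< (bound a)))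
  where
  x = φ zero
  y = φ (suc zero)
  z = φ (suc (suc zero))
  zy : Edge G z y
  zy = hom (suc (suc zero)) (suc zero) tt
  xy : Edge G x y
  xy = hom zero (suc zero) tt
  zl : ∀ i → Edge G z (φ (suc (suc (suc i))))
  zl i = hom (suc (suc zero)) (suc (suc (suc i))) tt
  -- Every vertex other than `z` stands for its edge to `z`; the slot of `z` itself holds the colour
  -- of `xy`. These are `3 + l` values below `2 + l`.
  col : Fin (3 + l) → ℕ
  col (suc (suc zero)) = c x y
  col a                = c z (φ a)
  bound : ∀ a → col a < 2 + l
  bound zero                = few _ _ zx
  bound (suc zero)          = few _ _ zy
  bound (suc (suc zero))    = few _ _ xy
  bound (suc (suc (suc i))) = few _ _ (zl i)
  z-inj : ∀ {a b} → Edge G z (φ a) → Edge G z (φ b) → c z (φ a) ≡ c z (φ b) → a ≡ b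
  z-inj e e′ eq = φ-inj (c-inj G c proper e e′ eq)
  y≢z : suc zero ≢ suc {2 + l} (suc zero)
  y≢z ()
  -- Only `xy` against a bristle needs the rainbow hypothesis; all other pairs of edges meet and are
  -- settled by properness.
  apart : ∀ a b → a Fin.< b → col a ≢ col b
  apart zero (suc zero) _ eq with z-inj zx zy eq
  ... | ()
  apart zero (suc (suc zero)) _ eq =
    y≢z (φ-inj (c-inj G c proper xy (edge-sym G zx) (trans (sym eq) (c-sym G c proper zx))))
  apart zero (suc (suc (suc i))) _ eq with z-inj zx (zl i) eq
  ... | ()
  apart (suc zero) (suc (suc zero)) _ eq with φ-inj (c-inj G c proper (edge-sym G zy) (edge-sym G xy)
      (trans (sym (c-sym G c proper zy)) (trans eq (c-sym G c proper xy))))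
  ... | ()
  apart (suc zero) (suc (suc (suc i))) _ eq with z-inj zy (zl i) eq
  ... | ()
  apart (suc (suc zero)) (suc (suc (suc i))) _ eq
    with rainbow zero (suc zero) (suc (suc zero)) (suc (suc (suc i))) tt tt eq
  ... | inj₁ ()
  ... | inj₂ ()
  apart (suc (suc (suc i))) (suc (suc (suc j))) i<j eq = <-irrefl (cong toℕ (z-inj (zl i) (zl j) eq)) i<j
  apart (suc zero) (suc zero) (s≤s ()) _
  apart (suc (suc zero)) (suc (suc zero)) (s≤s (s≤s ())) _
  apart (suc (suc zero)) (suc zero) (s≤s ()) _
  apart (suc (suc (suc _))) (suc zero) (s≤s ()) _
  apart (suc (suc (suc _))) (suc (suc zero)) (s≤s (s≤s ())) _
  clash : ¬ ∃ λ a → ∃ λ b → a Fin.< b × Fin.fromℕ< (bound a) ≡ Fin.fromℕ< (bound b)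
  clash (a , b , a<b , eq) = apart a b a<b
    (trans (sym (Fin.toℕ-fromℕ< (bound a))) (trans (cong toℕ eq) (Fin.toℕ-fromℕ< (bound b))))

-- Residues and the colouring of odd cliques

module _ {n} .{{_ : NonZero n}} where

  %-≡⇒∣ : ∀ m d → m % n ≡ (m + d) % n → n ∣ d
  %-≡⇒∣ m d eq = ∣m+n∣m⇒∣n (subst (n ∣_) (sym quotients) (n∣m*n ((m + d) / n))) (n∣m*n (m / n))
    where
    quotients : m / n * n + d ≡ (m + d) / n * n
    quotients = +-cancelˡ-≡ (m % n) _ _ (begin
      m % n + (m / n * n + d)           ≡⟨ +-assoc (m % n) _ d ⟨
      m % n + m / n * n + d             ≡⟨ cong (_+ d) (m≡m%n+[m/n]*n m n) ⟨
      m + d                             ≡⟨ m≡m%n+[m/n]*n (m + d) n ⟩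
      (m + d) % n + (m + d) / n * n     ≡⟨ cong (_+ (m + d) / n * n) eq ⟨
      m % n + (m + d) / n * n           ∎)
      where open ≡-Reasoning

  -- Equal residues make `n` divide `κ` times the difference, hence the difference itself by
  -- coprimality; but that is below `n`.
  %-cancel-≤ : ∀ κ → Coprime n κ → ∀ s a {x y} → s ≤ x → y < s + n → x ≤ y →
    (a + κ * x) % n ≡ (a + κ * y) % n → x ≡ y
  %-cancel-≤ κ coprime s a {x} s≤x y< x≤y eq with m≤n⇒∃[o]m+o≡n x≤y
  ... | zero  , refl = sym (+-identityʳ x)
  ... | suc d , refl = ⊥-elim (<⇒≱ d<n (∣⇒≤ (coprime-divisor coprime
          (%-≡⇒∣ (a + κ * x) (κ * suc d) (trans eq (cong (_% n) (expand a κ x (suc d))))))))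
    where
    expand : ∀ a κ x d → a + κ * (x + d) ≡ a + κ * x + κ * d
    expand = solve-∀
    d<n : suc d < n
    d<n = +-cancelˡ-< s _ _ (≤-<-trans (+-monoˡ-≤ (suc d) s≤x) y<)

  -- s , … , s + n − 1 is a complete set of residues.
  %-cancel : ∀ κ → Coprime n κ → ∀ s a {x y} → s ≤ x → x < s + n → s ≤ y → y < s + n →
    (a + κ * x) % n ≡ (a + κ * y) % n → x ≡ y
  %-cancel κ coprime s a {x} {y} s≤x x< s≤y y< eq with ≤-total x y
  ... | inj₁ x≤y = %-cancel-≤ κ coprime s a s≤x y< x≤y eq
  ... | inj₂ y≤x = sym (%-cancel-≤ κ coprime s a s≤y x< y≤x (sym eq))

odd-coprime-2 : ∀ j → Coprime (suc (2 * j)) 2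
odd-coprime-2 j {d} (d∣odd , d∣2) =
  ∣1⇒≡1 (∣m+n∣m⇒∣n (subst (d ∣_) (+-comm 1 (2 * j)) d∣odd) (∣-trans d∣2 (subst (2 ∣_) (*-comm j 2) (n∣m*n j))))

complete : ∀ n → Graph n
complete n = record
  { adj    = λ i j → not (i == j)
  ; sym    = λ i j → cong not (==-sym i j)
  ; irrefl = λ i → cong not (==-refl i)
  }
  where
  ==-refl : ∀ {n} (i : Fin n) → (i == i) ≡ true
  ==-refl i = dec-true (i Fin.≟ i) refl
  ==-sym : ∀ {n} (i j : Fin n) → (i == j) ≡ (j == i)
  ==-sym i j with i Fin.≟ j
  ... | yes refl = sym (==-refl i)
  ... | no i≢j = sym (dec-false (j Fin.≟ i) (i≢j ∘ sym))

complete-edge : ∀ {n} {i j : Fin n} → i ≢ j → Edge (complete n) i j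
complete-edge i≢j = T-not (i≢j ∘ T-==)

complete-degree : ∀ n (v : Fin n) → suc (degree (complete n) v) ≡ n
complete-degree n v = begin
  suc (degree (complete n) v)        ≡⟨ count-nbhd (complete n) v ⟨
  count (nbhd (complete n) v)        ≡⟨ sum-cong-≗ (λ w → ind-T (all w)) ⟩
  sum {n} (λ _ → 1)                  ≡⟨ trans (sum-const n 1) (*-identityʳ n) ⟩
  n                                  ∎
  where
  open ≡-Reasoning
  all : ∀ w → T (nbhd (complete n) v w)
  all w with w Fin.≟ v
  ... | yes _   = tt
  ... | no w≢v = complete-edge (w≢v ∘ sym)

complete-edgeCount : ∀ n → 2 * edgeCount (complete (suc n)) ≡ n * suc n
complete-edgeCount n = trans (handshake (complete (suc n)))
  (trans (sum-cong-≗ (λ v → suc-injective (complete-degree (suc n) v)))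
    (trans (sum-const (suc n) n) (*-comm (suc n) n)))

-- Any proper colouring will do, since K_k has fewer vertices than the broom.
clique-admissible : ∀ k → Admissible k (broom k) (edgeCount (complete k))
clique-admissible k = complete k , (λ u v → toℕ u + toℕ v) ,
  ((λ u v _ → +-comm (toℕ u) (toℕ v)) ,
   (λ u v w _ _ v≢w eq → v≢w (Fin.toℕ-injective (+-cancelˡ-≡ (toℕ u) _ _ eq)))) ,
  (λ (φ , φ-inj , _) → 1+n≰n (Fin.injective⇒≤ φ-inj)) , refl

-- The standard 1-factorisation of K_{k+1} for odd k, with `zero` as the point at infinity.
oddColour : ∀ k .{{_ : NonZero k}} → Colouring (suc k)
oddColour k zero    zero    = 0
oddColour k zero    (suc j) = (toℕ j + toℕ j) % k
oddColour k (suc i) zero    = (toℕ i + toℕ i) % k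
oddColour k (suc i) (suc j) = (toℕ i + toℕ j) % k

-- The edge from i to infinity takes i + i, the one sum that the edges from i to other residues
-- omit. At infinity the colours differ because doubling is injective for odd k.
oddColour-proper : ∀ k .{{_ : NonZero k}} → Coprime k 2 → Proper (complete (suc k)) (oddColour k)
oddColour-proper k coprime = symm , distinct
  where
  symm : ∀ u v → Edge (complete (suc k)) u v → oddColour k u v ≡ oddColour k v u
  symm zero    (suc j) _ = refl
  symm (suc i) zero    _ = refl
  symm (suc i) (suc j) _ = cong (_% k) (+-comm (toℕ i) (toℕ j))
  cancel : ∀ a (i j : Fin k) → (a + toℕ i) % k ≡ (a + toℕ j) % k → i ≡ j
  cancel a i j eq = Fin.toℕ-injective
    (%-cancel 1 (λ d → ∣1⇒≡1 (proj₂ d)) 0 a z≤n (Fin.toℕ<n i) z≤n (Fin.toℕ<n j)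
      (subst₂ (λ x y → (a + x) % k ≡ (a + y) % k) (sym (*-identityˡ (toℕ i))) (sym (*-identityˡ (toℕ j))) eq))
  cancel₂ : ∀ (i j : Fin k) → (toℕ i + toℕ i) % k ≡ (toℕ j + toℕ j) % k → i ≡ j
  cancel₂ i j eq = Fin.toℕ-injective
    (%-cancel 2 coprime 0 0 z≤n (Fin.toℕ<n i) z≤n (Fin.toℕ<n j)
      (subst₂ (λ x y → x % k ≡ y % k) (double (toℕ i)) (double (toℕ j)) eq))
    where
    double : ∀ x → x + x ≡ 2 * x
    double = solve-∀
  distinct : ∀ u v w → Edge (complete (suc k)) u v → Edge (complete (suc k)) u w → v ≢ w →
    oddColour k u v ≢ oddColour k u w
  distinct zero    (suc i) (suc j) _ _ v≢w eq = v≢w (cong suc (cancel₂ i j eq))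
  distinct (suc i) zero    zero    _ _ v≢w eq = v≢w refl
  distinct (suc i) zero    (suc j) _ e v≢w eq = edge-≢ (complete (suc k)) e (cong suc (cancel (toℕ i) i j eq))
  distinct (suc i) (suc j) zero    e _ v≢w eq = edge-≢ (complete (suc k)) e (sym (cong suc (cancel (toℕ i) j i eq)))
  distinct (suc i) (suc j) (suc h) _ _ v≢w eq = v≢w (cong suc (cancel (toℕ i) j h eq))

oddClique-admissible : ∀ l → Odd (2 + l) → Admissible (3 + l) (broom (2 + l)) (edgeCount (complete (3 + l)))
oddClique-admissible l (j , k≡) = complete (3 + l) , oddColour (2 + l) , proper ,
  fewColours-free (complete (3 + l)) (oddColour (2 + l)) proper few
    (λ z x z≢x ¬e → ⊥-elim (¬e (complete-edge z≢x))) , refl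
  where
  proper = oddColour-proper (2 + l) (subst (λ k → Coprime k 2) (sym k≡) (odd-coprime-2 j))
  few : ∀ u v → Edge (complete (3 + l)) u v → oddColour (2 + l) u v < 2 + l
  few zero    zero    _ = z<s
  few zero    (suc i) _ = m%n<n (toℕ i + toℕ i) (2 + l)
  few (suc i) zero    _ = m%n<n (toℕ i + toℕ i) (2 + l)
  few (suc i) (suc j) _ = m%n<n (toℕ i + toℕ j) (2 + l)

-- K₂ₘ₊₁ without an m-cycle

degree-full : ∀ {n} (G : Graph n) x → (∀ y → ¬ Edge G x y → y ≡ x) → n ≤ suc (degree G x)
degree-full {n} G x only = begin
  n                      ≡⟨ trans (sum-const n 1) (*-identityʳ n) ⟨
  sum {n} (λ _ → 1)      ≤⟨ sum-mono (λ y → ≤-reflexive (sym (ind-T (all y)))) ⟩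
  count (nbhd G x)       ≡⟨ count-nbhd G x ⟩
  suc (degree G x)       ∎
  where
  open ≤-Reasoning
  all : ∀ y → T (nbhd G x y)
  all y with T? (adj G x y)
  ... | yes e = T-∨ʳ {y == x} e
  ... | no ¬e = T-∨ˡ (==-T (only y ¬e))

degree-nearlyFull : ∀ {n} (G : Graph n) x y₁ y₂ →
  (∀ y → ¬ Edge G x y → y ≡ x ⊎ y ≡ y₁ ⊎ y ≡ y₂) → n ≤ degree G x + 3
degree-nearlyFull {n} G x y₁ y₂ only = begin
  n                          ≡⟨ trans (sum-const n 1) (*-identityʳ n) ⟨
  sum {n} (λ _ → 1)          ≤⟨ sum-mono all ⟩
  sum (λ y → ind (adj G x y) + (ind (y == x) + (ind (y == y₁) + ind (y == y₂))))
    ≡⟨ ∑-distrib-+ (λ y → ind (adj G x y)) (λ y → ind (y == x) + (ind (y == y₁) + ind (y == y₂))) ⟩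
  degree G x + sum (λ y → ind (y == x) + (ind (y == y₁) + ind (y == y₂)))
    ≡⟨ cong (degree G x +_) (trans (∑-distrib-+ (λ y → ind (y == x)) (λ y → ind (y == y₁) + ind (y == y₂)))
         (cong₂ _+_ (count-== x) (trans (∑-distrib-+ (λ y → ind (y == y₁)) (λ y → ind (y == y₂)))
           (cong₂ _+_ (count-== y₁) (count-== y₂))))) ⟩
  degree G x + 3             ∎
  where
  open ≤-Reasoning
  self : ∀ (y : Fin n) → 1 ≤ ind (y == y)
  self y = ≤-reflexive (sym (ind-T (==-T {i = y} refl)))
  all : ∀ y → 1 ≤ ind (adj G x y) + (ind (y == x) + (ind (y == y₁) + ind (y == y₂)))
  all y with T? (adj G x y)
  ... | yes e = ≤-trans (≤-reflexive (sym (ind-T e))) (m≤m+n _ _)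
  ... | no ¬e with only y ¬e
  ...   | inj₁ refl        = ≤-trans (self y) (≤-trans (m≤m+n _ _) (m≤n+m _ (ind (adj G x y))))
  ...   | inj₂ (inj₁ refl) = ≤-trans (self y) (≤-trans (m≤m+n _ _)
                               (≤-trans (m≤n+m _ (ind (y == x))) (m≤n+m _ (ind (adj G x y)))))
  ...   | inj₂ (inj₂ refl) = ≤-trans (self y) (≤-trans (m≤n+m _ (ind (y == y₁)))
                               (≤-trans (m≤n+m _ (ind (y == x))) (m≤n+m _ (ind (adj G x y)))))

degreeSum-↑ : ∀ a b (G : Graph (a + b)) p q → (∀ i → p ≤ degree G (i Fin.↑ˡ b)) →
  (∀ j → q ≤ degree G (a Fin.↑ʳ j)) → a * p + b * q ≤ degreeSum G
degreeSum-↑ a b G p q left right = begin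
  a * p + b * q                              ≡⟨ cong₂ _+_ (sum-const a p) (sum-const b q) ⟨
  sum {a} (λ _ → p) + sum {b} (λ _ → q)      ≤⟨ +-mono-≤ (sum-mono left) (sum-mono right) ⟩
  sum (λ i → degree G (i Fin.↑ˡ b)) + sum (λ j → degree G (a Fin.↑ʳ j)) ≡⟨ sum-↑ a (degree G) ⟨
  degreeSum G                                ∎
  where open ≤-Reasoning

-- Indices are plain naturals, which keeps the label arithmetic out of `Fin`; `Ord` and `Ok` impose
-- the ranges later.
data V : Set where
  A B : ℕ → V
  ∞ u : V

A-injective : ∀ {i j} → A i ≡ A j → i ≡ j
A-injective refl = refl

B-injective : ∀ {i j} → B i ≡ B j → i ≡ j
B-injective refl = refl

≡ᵇ-refl : ∀ i → (i ≡ᵇ i) ≡ true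
≡ᵇ-refl zero    = refl
≡ᵇ-refl (suc i) = ≡ᵇ-refl i

≡ᵇ-sym : ∀ i j → (i ≡ᵇ j) ≡ (j ≡ᵇ i)
≡ᵇ-sym zero    zero    = refl
≡ᵇ-sym zero    (suc j) = refl
≡ᵇ-sym (suc i) zero    = refl
≡ᵇ-sym (suc i) (suc j) = ≡ᵇ-sym i j

module Cycle (r : ℕ) where

  last size : ℕ
  last   = 2 + r
  size = suc last

  next prev : ℕ → ℕ
  next i with i ≟ last
  ... | yes _ = 0
  ... | no _  = suc i
  prev zero    = last
  prev (suc i) = i

  next< : ∀ {i} → i < size → next i < size
  next< {i} i< with i ≟ last
  ... | yes _ = z<s
  ... | no i≢ = s≤s (≤∧≢⇒< (s≤s⁻¹ i<) i≢)

  next≢ : ∀ i → next i ≢ i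
  next≢ i e with i ≟ last
  next≢ .last () | yes refl
  next≢ i e | no _ = 1+n≢n e

  -- Here the cycle length, at least three, enters: the two non-neighbours of a cycle vertex are
  -- different.
  next-next≢ : ∀ i → next (next i) ≢ i
  next-next≢ i e with i ≟ last
  next-next≢ .last e | yes refl with 0 ≟ last
  next-next≢ .last () | yes refl | no _
  next-next≢ i e | no _ with suc i ≟ last
  next-next≢ .(suc r) () | no _ | yes refl
  next-next≢ i e | no _ | no _ = m+1+n≢m i (trans (trans (+-suc i 1) (cong suc (+-comm i 1))) e)

  prev< : ∀ {i} → i < size → prev i < size
  prev< {zero}  _  = ≤-refl
  prev< {suc i} i< = <⇒≤ i<

  next-prev : ∀ {i} → i < size → next (prev i) ≡ i
  next-prev {zero} _ with last ≟ last
  ... | yes _ = refl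
  ... | no ¬e = ⊥-elim (¬e refl)
  next-prev {suc i} i< with i ≟ last
  ... | yes refl = ⊥-elim (<-irrefl refl i<)
  ... | no _ = refl

  prev-next : ∀ i → prev (next i) ≡ i
  prev-next i with i ≟ last
  ... | yes e = sym e
  ... | no _  = refl

  consecutive : ℕ → ℕ → Bool
  consecutive i j = (j ≡ᵇ next i) ∨ (i ≡ᵇ next j)

-- With m = 3 + r, the complete graph on A₀ … A₍ₘ₋₁₎ , B₀ … B₍ₘ₋₂₎ , ∞ , u loses the cycle of the Aᵢ.
-- On the vertices other than u start from the standard 1-factorisation of K₂ₘ with the colours
-- 0 , … , n − 1, where n = 2m − 1 and Aᵢ , Bᵢ sit at the residues α i , β i. The edges AᵢBᵢ are
-- recoloured by n. Now each Aᵢ lacks the old colour of AᵢAᵢ₊₁, each Bᵢ the old colour of AᵢBᵢ and ∞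
-- the colour n, and these are the colours of the edges to u.
module EvenBase (r : ℕ) (α β : ℕ → ℕ) where

  open Cycle r

  n : ℕ
  n = suc (2 * last)

  data Ord : V → Set where
    isA : ∀ {i} → i < size → Ord (A i)
    isB : ∀ {i} → i < last → Ord (B i)

  data Ok : V → Set where
    ord : ∀ {v} → Ord v → Ok v
    is∞ : Ok ∞
    isu : Ok u

  pos : V → ℕ
  pos (A i) = α i
  pos (B i) = β i
  pos _     = 0

  -- The edge from `v` to `partner v` is the one, deleted or recoloured, whose old colour `link v`
  -- is handed on to the edge from `v` to `u`.
  partner : V → V
  partner (A i) = A (next i)
  partner (B i) = A i
  partner v     = v

  link : V → ℕ
  link v = (pos v + pos (partner v)) % n

  adjV : V → V → Bool
  adjV (A i) (A j) = not (i ≡ᵇ j) ∧ not (consecutive i j)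
  adjV (A _) _     = true
  adjV (B i) (B j) = not (i ≡ᵇ j)
  adjV (B _) _     = true
  adjV ∞     ∞     = false
  adjV ∞     _     = true
  adjV u     u     = false
  adjV u     _     = true

  spoke : ℕ → ℕ → ℕ
  spoke i j with i ≟ j
  ... | yes _ = n
  ... | no _  = (α i + β j) % n

  colV : V → V → ℕ
  colV (A i) (A j) = (α i + α j) % n
  colV (A i) (B j) = spoke i j
  colV (B i) (A j) = spoke j i
  colV (B i) (B j) = (β i + β j) % n
  colV (A i) ∞     = (α i + α i) % n
  colV (B i) ∞     = (β i + β i) % n
  colV ∞     (A i) = (α i + α i) % n
  colV ∞     (B i) = (β i + β i) % n
  colV (A i) u     = link (A i)
  colV (B i) u     = link (B i)
  colV u     (A i) = link (A i)
  colV u     (B i) = link (B i)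
  -- The only edge covered by this clause joins `∞` and `u`.
  colV _     _     = n

  adjV-sym : ∀ v w → adjV v w ≡ adjV w v
  adjV-sym (A i) (A j) = cong₂ (λ a b → not a ∧ not b) (≡ᵇ-sym i j) (∨-comm (j ≡ᵇ next i) (i ≡ᵇ next j))
  adjV-sym (A _) (B _) = refl
  adjV-sym (A _) ∞     = refl
  adjV-sym (A _) u     = refl
  adjV-sym (B _) (A _) = refl
  adjV-sym (B i) (B j) = cong not (≡ᵇ-sym i j)
  adjV-sym (B _) ∞     = refl
  adjV-sym (B _) u     = refl
  adjV-sym ∞     (A _) = refl
  adjV-sym ∞     (B _) = refl
  adjV-sym ∞     ∞     = refl
  adjV-sym ∞     u     = refl
  adjV-sym u     (A _) = refl
  adjV-sym u     (B _) = refl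
  adjV-sym u     ∞     = refl
  adjV-sym u     u     = refl

  adjV-irrefl : ∀ v → adjV v v ≡ false
  adjV-irrefl (A i) rewrite ≡ᵇ-refl i = refl
  adjV-irrefl (B i) rewrite ≡ᵇ-refl i = refl
  adjV-irrefl ∞ = refl
  adjV-irrefl u = refl

  adjV-≢ : ∀ {v w} → T (adjV v w) → v ≢ w
  adjV-≢ {v} e refl = subst T (adjV-irrefl v) e

  colV-sym : ∀ v w → T (adjV v w) → colV v w ≡ colV w v
  colV-sym (A i) (A j) _ = cong (_% n) (+-comm (α i) (α j))
  colV-sym (A _) (B _) _ = refl
  colV-sym (A _) ∞     _ = refl
  colV-sym (A _) u     _ = refl
  colV-sym (B _) (A _) _ = refl
  colV-sym (B i) (B j) _ = cong (_% n) (+-comm (β i) (β j))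
  colV-sym (B _) ∞     _ = refl
  colV-sym (B _) u     _ = refl
  colV-sym ∞     (A _) _ = refl
  colV-sym ∞     (B _) _ = refl
  colV-sym ∞     u     _ = refl
  colV-sym u     (A _) _ = refl
  colV-sym u     (B _) _ = refl
  colV-sym u     ∞     _ = refl

  %<n : ∀ x → x % n < n
  %<n x = m%n<n x n

  spoke≤n : ∀ i j → spoke i j ≤ n
  spoke≤n i j with i ≟ j
  ... | yes _ = ≤-refl
  ... | no _  = <⇒≤ (%<n (α i + β j))

  colV≤n : ∀ v w → colV v w ≤ n
  colV≤n (A i) (A j) = <⇒≤ (%<n (α i + α j))
  colV≤n (A i) (B j) = spoke≤n i j
  colV≤n (A i) ∞     = <⇒≤ (%<n (α i + α i))
  colV≤n (A i) u     = <⇒≤ (%<n (α i + α (next i)))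
  colV≤n (B i) (A j) = spoke≤n j i
  colV≤n (B i) (B j) = <⇒≤ (%<n (β i + β j))
  colV≤n (B i) ∞     = <⇒≤ (%<n (β i + β i))
  colV≤n (B i) u     = <⇒≤ (%<n (β i + α i))
  colV≤n ∞     (A i) = <⇒≤ (%<n (α i + α i))
  colV≤n ∞     (B i) = <⇒≤ (%<n (β i + β i))
  colV≤n ∞     ∞     = ≤-refl
  colV≤n ∞     u     = ≤-refl
  colV≤n u     (A i) = <⇒≤ (%<n (α i + α (next i)))
  colV≤n u     (B i) = <⇒≤ (%<n (β i + α i))
  colV≤n u     ∞     = ≤-refl
  colV≤n u     u     = ≤-refl

  nonAdjacent-A : ∀ i w → ¬ T (adjV (A i) w) → ∃ λ j → w ≡ A j × (j ≡ i ⊎ j ≡ next i ⊎ j ≡ prev i)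
  nonAdjacent-A i (A j) ¬e = j , refl , cases
    where
    cases : j ≡ i ⊎ j ≡ next i ⊎ j ≡ prev i
    cases with T? (i ≡ᵇ j) | T? (j ≡ᵇ next i) | T? (i ≡ᵇ next j)
    ... | yes p | _     | _     = inj₁ (sym (≡ᵇ⇒≡ _ _ p))
    ... | no _  | yes p | _     = inj₂ (inj₁ (≡ᵇ⇒≡ _ _ p))
    ... | no _  | no _  | yes p = inj₂ (inj₂ (trans (sym (prev-next j)) (cong prev (sym (≡ᵇ⇒≡ i (next j) p)))))
    ... | no a  | no b  | no c  = ⊥-elim (¬e (T-∧⁺ (T-not a) (T-not (λ t → neither (T-∨⁻ t)))))
      where
      neither : ¬ (T (j ≡ᵇ next i) ⊎ T (i ≡ᵇ next j))
      neither (inj₁ t) = b t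
      neither (inj₂ t) = c t
  nonAdjacent-A i (B _) ¬e = ⊥-elim (¬e tt)
  nonAdjacent-A i ∞     ¬e = ⊥-elim (¬e tt)
  nonAdjacent-A i u     ¬e = ⊥-elim (¬e tt)

  next-nonAdjacent : ∀ i → ¬ T (adjV (A i) (A (next i)))
  next-nonAdjacent i e = not-T (proj₂ (T-∧⁻ {not (i ≡ᵇ next i)} e)) (T-∨ˡ (≡⇒≡ᵇ (next i) (next i) refl))

  prev-nonAdjacent : ∀ {i} → i < size → ¬ T (adjV (A i) (A (prev i)))
  prev-nonAdjacent {i} i< e = not-T (proj₂ (T-∧⁻ {not (i ≡ᵇ prev i)} e))
    (T-∨ʳ {prev i ≡ᵇ next i} (≡⇒≡ᵇ i (next (prev i)) (sym (next-prev i<))))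

  prev≢ : ∀ {i} → i < size → prev i ≢ i
  prev≢ i< e = next≢ _ (trans (cong next (sym e)) (next-prev i<))

  prev≢next : ∀ {i} → i < size → prev i ≢ next i
  prev≢next {i} i< e = next-next≢ (prev i) (trans (cong next (next-prev i<)) (sym e))

  nonAdjacent-rest : ∀ {v} w → (∀ i → v ≢ A i) → ¬ T (adjV v w) → w ≡ v
  nonAdjacent-rest {A i} w ≢A _ = ⊥-elim (≢A i refl)
  nonAdjacent-rest {B i} (A _) _ ¬e = ⊥-elim (¬e tt)
  nonAdjacent-rest {B i} (B j) _ ¬e with T? (i ≡ᵇ j)
  ... | yes p = cong B (sym (≡ᵇ⇒≡ _ _ p))
  ... | no ¬p = ⊥-elim (¬e (T-not ¬p))
  nonAdjacent-rest {B i} ∞ _ ¬e = ⊥-elim (¬e tt)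
  nonAdjacent-rest {B i} u _ ¬e = ⊥-elim (¬e tt)
  nonAdjacent-rest {∞} (A _) _ ¬e = ⊥-elim (¬e tt)
  nonAdjacent-rest {∞} (B _) _ ¬e = ⊥-elim (¬e tt)
  nonAdjacent-rest {∞} ∞ _ ¬e = refl
  nonAdjacent-rest {∞} u _ ¬e = ⊥-elim (¬e tt)
  nonAdjacent-rest {u} (A _) _ ¬e = ⊥-elim (¬e tt)
  nonAdjacent-rest {u} (B _) _ ¬e = ⊥-elim (¬e tt)
  nonAdjacent-rest {u} ∞ _ ¬e = ⊥-elim (¬e tt)
  nonAdjacent-rest {u} u _ ¬e = refl

  -- Only cycle vertices have non-neighbours, namely their two neighbours on the cycle; if `x` is
  -- one of these, the other serves.
  secondNonNeighbour : ∀ z x → Ok z → z ≢ x → ¬ T (adjV z x) →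
    ∃ λ x′ → Ok x′ × x′ ≢ x × x′ ≢ z × ¬ T (adjV z x′)
  secondNonNeighbour (A i) x (ord (isA i<)) z≢x ¬e with nonAdjacent-A i x ¬e
  ... | j , refl , inj₁ refl = ⊥-elim (z≢x refl)
  ... | j , refl , inj₂ (inj₁ refl) = A (prev i) , ord (isA (prev< i<)) ,
        prev≢next i< ∘ A-injective , prev≢ i< ∘ A-injective , prev-nonAdjacent i<
  ... | j , refl , inj₂ (inj₂ refl) = A (next i) , ord (isA (next< i<)) ,
        (λ e → prev≢next i< (sym (A-injective e))) , next≢ i ∘ A-injective , next-nonAdjacent i
  secondNonNeighbour (B i) x _ z≢x ¬e = ⊥-elim (z≢x (sym (nonAdjacent-rest x (λ _ ()) ¬e)))
  secondNonNeighbour ∞ x _ z≢x ¬e = ⊥-elim (z≢x (sym (nonAdjacent-rest x (λ _ ()) ¬e)))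
  secondNonNeighbour u x _ z≢x ¬e = ⊥-elim (z≢x (sym (nonAdjacent-rest x (λ _ ()) ¬e)))

  -- The parameters describe a harmonious labelling: positions are distinct within a window of `n`
  -- consecutive integers, and the sums along the edges to partners are distinct modulo `n`.
  module Labelled (s : ℕ)
    (window : ∀ {v} → Ord v → s ≤ pos v × pos v < s + n)
    (pos-injective : ∀ {v w} → Ord v → Ord w → pos v ≡ pos w → v ≡ w)
    (link-injective : ∀ {v w} → Ord v → Ord w → link v ≡ link w → v ≡ w) where

    cancel : ∀ a {v w} → Ord v → Ord w → (a + pos v) % n ≡ (a + pos w) % n → v ≡ w
    cancel a {v} {w} ov ow eq = pos-injective ov ow
      (%-cancel 1 (λ d → ∣1⇒≡1 (proj₂ d)) s a
        (proj₁ (window ov)) (proj₂ (window ov)) (proj₁ (window ow)) (proj₂ (window ow))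
        (subst₂ (λ x y → (a + x) % n ≡ (a + y) % n) (sym (*-identityˡ (pos v))) (sym (*-identityˡ (pos w))) eq))

    cancel₂ : ∀ {v w} → Ord v → Ord w → (pos v + pos v) % n ≡ (pos w + pos w) % n → v ≡ w
    cancel₂ {v} {w} ov ow eq = pos-injective ov ow
      (%-cancel 2 (odd-coprime-2 last) s 0
        (proj₁ (window ov)) (proj₂ (window ov)) (proj₁ (window ow)) (proj₂ (window ow))
        (subst₂ (λ x y → x % n ≡ y % n) (double (pos v)) (double (pos w)) eq))
      where
      double : ∀ x → x + x ≡ 2 * x
      double = solve-∀

    -- The edge from an ordinary vertex v to w has colour n, or pos v + pos θ (mod n) for a vertex θ
    -- that stands in for w.
    data StandsFor (v : V) : V → V → Set where
      itself  : ∀ {w} → w ≢ v → w ≢ partner v → StandsFor v w w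
      for-∞   : StandsFor v v ∞
      for-u   : StandsFor v (partner v) u

    twin : V → V
    twin (A i) = B i
    twin (B i) = A i
    twin v     = v

    Row : V → V → Set
    Row v w = (colV v w ≡ n × w ≡ twin v) ⊎
      (∃ λ θ → Ord θ × StandsFor v θ w × colV v w ≡ (pos v + pos θ) % n)

    row : ∀ {v w} → Ord v → Ok w → T (adjV v w) → Row v w
    row {A i} {A j} _ (ord oj) e = inj₂ (A j , oj ,
      itself (λ eq → adjV-≢ {A i} {A j} e (sym eq)) (λ { refl → next-nonAdjacent i e }) , refl)
    row {A i} {B j} _ (ord oj) e with i ≟ j
    ... | yes refl = inj₁ (refl , refl)
    ... | no _     = inj₂ (B j , oj , itself (λ ()) (λ ()) , refl)
    row {A i} {∞} oi _ _ = inj₂ (A i , oi , for-∞ , refl)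
    row {A i} {u} (isA i<) _ _ = inj₂ (A (next i) , isA (next< i<) , for-u , refl)
    row {B i} {A j} _ (ord oj) e with j ≟ i
    ... | yes refl = inj₁ (refl , refl)
    ... | no j≢i   = inj₂ (A j , oj , itself (λ ()) (j≢i ∘ A-injective) , cong (_% n) (+-comm (α j) (β i)))
    row {B i} {B j} _ (ord oj) e = inj₂ (B j , oj ,
      itself (λ eq → adjV-≢ {B i} {B j} e (sym eq)) (λ ()) , refl)
    row {B i} {∞} oi _ _ = inj₂ (B i , oi , for-∞ , refl)
    row {B i} {u} (isB i<) _ _ = inj₂ (A i , isA (<-trans i< ≤-refl) , for-u , refl)

    partner≢ : ∀ {v} → Ord v → partner v ≢ v
    partner≢ (isA {i} _) = next≢ i ∘ A-injective
    partner≢ (isB _) ()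

    -- The side conditions of `itself` reserve the stand-ins `v` and `partner v` for `∞` and `u`.
    standsFor-unique : ∀ {v θ θ′ w w′} → Ord v → StandsFor v θ w → StandsFor v θ′ w′ → θ ≡ θ′ → w ≡ w′
    standsFor-unique _  (itself _ _) (itself _ _) refl = refl
    standsFor-unique _  (itself p _) for-∞        refl = ⊥-elim (p refl)
    standsFor-unique _  (itself _ p) for-u        refl = ⊥-elim (p refl)
    standsFor-unique _  for-∞        (itself p _) refl = ⊥-elim (p refl)
    standsFor-unique _  for-∞        for-∞        _    = refl
    standsFor-unique ov for-∞        for-u        eq   = ⊥-elim (partner≢ ov (sym eq))
    standsFor-unique _  for-u        (itself _ p) refl = ⊥-elim (p refl)
    standsFor-unique ov for-u        for-∞        eq   = ⊥-elim (partner≢ ov eq)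
    standsFor-unique _  for-u        for-u        _    = refl

    %≢n : ∀ x → x % n ≢ n
    %≢n x = <⇒≢ (%<n x)

    -- Colour `n` leads only to the twin. For a smaller colour, cancelling `pos v` identifies the
    -- stand-ins.
    distinct-ord : ∀ {v w w′} → Ord v → Row v w → Row v w′ → colV v w ≡ colV v w′ → w ≡ w′
    distinct-ord ov (inj₁ (_ , e)) (inj₁ (_ , e′)) eq = trans e (sym e′)
    distinct-ord {v} ov (inj₁ (e , _)) (inj₂ (θ , _ , _ , e′)) eq = ⊥-elim (%≢n (pos v + pos θ) (trans (sym e′) (trans (sym eq) e)))
    distinct-ord {v} ov (inj₂ (θ , _ , _ , e)) (inj₁ (e′ , _)) eq = ⊥-elim (%≢n (pos v + pos θ) (trans (sym e) (trans eq e′)))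
    distinct-ord {v} ov (inj₂ (θ , oθ , sf , e)) (inj₂ (θ′ , oθ′ , sf′ , e′)) eq =
      standsFor-unique ov sf sf′ (cancel (pos v) oθ oθ′ (trans (sym e) (trans eq e′)))

    colV-∞ : ∀ {w} → Ord w → colV ∞ w ≡ (pos w + pos w) % n
    colV-∞ (isA _) = refl
    colV-∞ (isB _) = refl

    colV-u : ∀ {w} → Ord w → colV u w ≡ link w
    colV-u (isA _) = refl
    colV-u (isB _) = refl

    -- At `∞` the colours below `n` are doubled residues, distinct because `n` is odd; at `u` they
    -- are the links.
    distinct : ∀ {v w w′} → Ok v → Ok w → Ok w′ → T (adjV v w) → T (adjV v w′) → colV v w ≡ colV v w′ → w ≡ w′
    distinct (ord ov) ow ow′ e e′ eq = distinct-ord ov (row ov ow e) (row ov ow′ e′) eq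
    distinct is∞ (ord ow) (ord ow′) _ _ eq = cancel₂ ow ow′ (trans (sym (colV-∞ ow)) (trans eq (colV-∞ ow′)))
    distinct {w = w} is∞ (ord ow) isu _ _ eq = ⊥-elim (%≢n (pos w + pos w) (trans (sym (colV-∞ ow)) eq))
    distinct {w′ = w} is∞ isu (ord ow) _ _ eq = ⊥-elim (%≢n (pos w + pos w) (trans (sym (colV-∞ ow)) (sym eq)))
    distinct is∞ isu isu _ _ _ = refl
    distinct isu (ord ow) (ord ow′) _ _ eq = link-injective ow ow′ (trans (sym (colV-u ow)) (trans eq (colV-u ow′)))
    distinct {w = w} isu (ord ow) is∞ _ _ eq = ⊥-elim (%≢n (pos w + pos (partner w)) (trans (sym (colV-u ow)) eq))
    distinct {w′ = w} isu is∞ (ord ow) _ _ eq = ⊥-elim (%≢n (pos w + pos (partner w)) (trans (sym (colV-u ow)) (sym eq)))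
    distinct isu is∞ is∞ _ _ _ = refl

    -- `2 + l` is k = 2m, and `N` computes to `3 + l`, the number of vertices that `fewColours-free`
    -- expects.
    l N : ℕ
    l = r + (last + 2)
    N = size + (last + 2)

    code : Fin size ⊎ (Fin last ⊎ Fin 2) → V
    code (inj₁ i)                = A (toℕ i)
    code (inj₂ (inj₁ i))         = B (toℕ i)
    code (inj₂ (inj₂ zero))      = ∞
    code (inj₂ (inj₂ (suc _)))   = u

    code-injective : ∀ s t → code s ≡ code t → s ≡ t
    code-injective (inj₁ i) (inj₁ j) e = cong inj₁ (Fin.toℕ-injective (A-injective e))
    code-injective (inj₂ (inj₁ i)) (inj₂ (inj₁ j)) e = cong (inj₂ ∘ inj₁) (Fin.toℕ-injective (B-injective e))
    code-injective (inj₂ (inj₂ zero)) (inj₂ (inj₂ zero)) _ = refl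
    code-injective (inj₂ (inj₂ (suc zero))) (inj₂ (inj₂ (suc zero))) _ = refl
    code-injective (inj₁ _) (inj₂ (inj₁ _)) ()
    code-injective (inj₁ _) (inj₂ (inj₂ zero)) ()
    code-injective (inj₁ _) (inj₂ (inj₂ (suc _))) ()
    code-injective (inj₂ (inj₁ _)) (inj₁ _) ()
    code-injective (inj₂ (inj₁ _)) (inj₂ (inj₂ zero)) ()
    code-injective (inj₂ (inj₁ _)) (inj₂ (inj₂ (suc _))) ()
    code-injective (inj₂ (inj₂ zero)) (inj₁ _) ()
    code-injective (inj₂ (inj₂ zero)) (inj₂ (inj₁ _)) ()
    code-injective (inj₂ (inj₂ zero)) (inj₂ (inj₂ (suc _))) ()
    code-injective (inj₂ (inj₂ (suc _))) (inj₁ _) ()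
    code-injective (inj₂ (inj₂ (suc _))) (inj₂ (inj₁ _)) ()
    code-injective (inj₂ (inj₂ (suc _))) (inj₂ (inj₂ zero)) ()

    code-Ok : ∀ s → Ok (code s)
    code-Ok (inj₁ i)              = ord (isA (Fin.toℕ<n i))
    code-Ok (inj₂ (inj₁ i))       = ord (isB (Fin.toℕ<n i))
    code-Ok (inj₂ (inj₂ zero))    = is∞
    code-Ok (inj₂ (inj₂ (suc _))) = isu

    code-surjective : ∀ {v} → Ok v → ∃ λ s → code s ≡ v
    code-surjective (ord (isA i<)) = inj₁ (Fin.fromℕ< i<) , cong A (Fin.toℕ-fromℕ< i<)
    code-surjective (ord (isB i<)) = inj₂ (inj₁ (Fin.fromℕ< i<)) , cong B (Fin.toℕ-fromℕ< i<)
    code-surjective is∞            = inj₂ (inj₂ zero) , refl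
    code-surjective isu            = inj₂ (inj₂ (suc zero)) , refl

    split : Fin N → Fin size ⊎ (Fin last ⊎ Fin 2)
    split x with Fin.splitAt size x
    ... | inj₁ i = inj₁ i
    ... | inj₂ y = inj₂ (Fin.splitAt last y)

    unsplit : Fin size ⊎ (Fin last ⊎ Fin 2) → Fin N
    unsplit (inj₁ i) = i Fin.↑ˡ (last + 2)
    unsplit (inj₂ t) = size Fin.↑ʳ Fin.join last 2 t

    unsplit-split : ∀ x → unsplit (split x) ≡ x
    unsplit-split x with Fin.splitAt size x in eq
    ... | inj₁ i = Fin.splitAt⁻¹-↑ˡ eq
    ... | inj₂ y = trans (cong (size Fin.↑ʳ_) (Fin.join-splitAt last 2 y)) (Fin.splitAt⁻¹-↑ʳ eq)

    split-unsplit : ∀ s → split (unsplit s) ≡ s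
    split-unsplit (inj₁ i) rewrite Fin.splitAt-↑ˡ size i (last + 2) = refl
    split-unsplit (inj₂ t) rewrite Fin.splitAt-↑ʳ size (last + 2) (Fin.join last 2 t) =
      cong inj₂ (Fin.splitAt-join last 2 t)

    decode : Fin N → V
    decode x = code (split x)

    decode-injective : ∀ x y → decode x ≡ decode y → x ≡ y
    decode-injective x y e =
      trans (sym (unsplit-split x)) (trans (cong unsplit (code-injective (split x) (split y) e)) (unsplit-split y))

    decode-Ok : ∀ x → Ok (decode x)
    decode-Ok x = code-Ok (split x)

    encode : ∀ {v} → Ok v → ∃ λ x → decode x ≡ v
    encode ok with code-surjective ok
    ... | s , e = unsplit s , trans (cong code (split-unsplit s)) e

    graph : Graph N
    graph = record
      { adj    = λ x y → adjV (decode x) (decode y)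
      ; sym    = λ x y → adjV-sym (decode x) (decode y)
      ; irrefl = λ x → adjV-irrefl (decode x)
      }

    colouring : Colouring N
    colouring x y = colV (decode x) (decode y)

    proper : Proper graph colouring
    proper = (λ x y e → colV-sym (decode x) (decode y) e) ,
      λ x y z e e′ y≢z eq → y≢z (decode-injective y z (distinct (decode-Ok x) (decode-Ok y) (decode-Ok z) e e′ eq))

    free : RainbowFree graph colouring (broom (2 + l))
    free = fewColours-free graph colouring proper few second
      where
      few : ∀ x y → Edge graph x y → colouring x y < 2 + l
      few x y _ = ≤-trans (s≤s (colV≤n (decode x) (decode y))) (≤-reflexive (lem r))
        where
        lem : ∀ r → suc (suc (2 * (2 + r))) ≡ 2 + (r + (2 + r + 2))
        lem = solve-∀
      second : ∀ z x → z ≢ x → ¬ Edge graph z x → ∃ λ x′ → x′ ≢ x × x′ ≢ z × ¬ Edge graph z x′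
      second z x z≢x ¬zx with secondNonNeighbour (decode z) (decode x) (decode-Ok z) (z≢x ∘ decode-injective z x) ¬zx
      ... | v , ok , v≢x , v≢z , ¬zv with encode ok
      ...   | x′ , refl = x′ , v≢x ∘ cong decode , v≢z ∘ cong decode , ¬zv

    degree-rest : ∀ x → (∀ i → decode x ≢ A i) → 2 + l ≤ degree graph x
    degree-rest x ≢A = s≤s⁻¹ (degree-full graph x (λ y ¬e →
      decode-injective y x (nonAdjacent-rest (decode y) ≢A ¬e)))

    degree-A : ∀ x {i} → i < size → decode x ≡ A i → l ≤ degree graph x
    degree-A x {i} i< x≡ with encode (ord (isA (next< i<))) | encode (ord (isA (prev< i<)))
    ... | y₁ , y₁≡ | y₂ , y₂≡ = +-cancelʳ-≤ 3 l (degree graph x)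
      (≤-trans (≤-reflexive (+-comm l 3)) (degree-nearlyFull graph x y₁ y₂ only))
      where
      only : ∀ y → ¬ Edge graph x y → y ≡ x ⊎ y ≡ y₁ ⊎ y ≡ y₂
      only y ¬e with nonAdjacent-A i (decode y) (λ t → ¬e (subst (λ v → T (adjV v (decode y))) (sym x≡) t))
      ... | j , y≡ , inj₁ refl        = inj₁ (decode-injective y x (trans y≡ (sym x≡)))
      ... | j , y≡ , inj₂ (inj₁ refl) = inj₂ (inj₁ (decode-injective y y₁ (trans y≡ (sym y₁≡))))
      ... | j , y≡ , inj₂ (inj₂ refl) = inj₂ (inj₂ (decode-injective y y₂ (trans y≡ (sym y₂≡))))

    -- The m cycle vertices have degree at least k - 2 and the other m + 1 at least k; the total (2m
    -- + 1)k - 2m is k², since k = 2m.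
    degreeSum≥ : (2 + l) * (2 + l) ≤ degreeSum graph
    degreeSum≥ = ≤-trans (≤-reflexive (total r)) (degreeSum-↑ size (last + 2) graph l (2 + l) cycle rest)
      where
      total : ∀ r → (2 + (r + (2 + r + 2))) * (2 + (r + (2 + r + 2))) ≡
        (3 + r) * (r + (2 + r + 2)) + (2 + r + 2) * (2 + (r + (2 + r + 2)))
      total = solve-∀
      cycle : ∀ i → l ≤ degree graph (i Fin.↑ˡ (last + 2))
      cycle i = degree-A (i Fin.↑ˡ (last + 2)) (Fin.toℕ<n i) (cong code (split-unsplit (inj₁ i)))
      rest : ∀ y → 2 + l ≤ degree graph (size Fin.↑ʳ y)
      rest y = degree-rest (size Fin.↑ʳ y) (λ i e → not-A (Fin.splitAt last y) i (trans (sym at) e))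
        where
        at : decode (size Fin.↑ʳ y) ≡ code (inj₂ (Fin.splitAt last y))
        at rewrite Fin.splitAt-↑ʳ size (last + 2) y = refl
        not-A : ∀ t i → code (inj₂ t) ≢ A i
        not-A (inj₁ _) i ()
        not-A (inj₂ zero) i ()
        not-A (inj₂ (suc _)) i ()

    admissible : ∃ λ e → Admissible (3 + l) (broom (2 + l)) e × (2 + l) * (2 + l) ≤ 2 * e
    admissible = edgeCount graph , (graph , colouring , proper , free , refl) ,
      ≤-trans degreeSum≥ (≤-reflexive (sym (handshake graph)))

-- Harmonious labellings certified by blocks

offset : (ℕ → ℕ) → ℕ → ℕ
offset len zero    = 0
offset len (suc i) = offset len i + len i

offset-mono : ∀ len {i j} → i ≤ j → offset len i ≤ offset len j
offset-mono len {i} {j} i≤j with m≤n⇒∃[o]m+o≡n i≤j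
... | d , refl = go d
  where
  go : ∀ d → offset len i ≤ offset len (i + d)
  go zero    rewrite +-identityʳ i = ≤-refl
  go (suc d) rewrite +-suc i d = ≤-trans (go d) (m≤m+n _ _)

offset-< : ∀ len {i j t t′} → i < j → t < len i → offset len i + t < offset len j + t′
offset-< len {i} {j} {t} {t′} i<j t< = begin-strict
  offset len i + t       <⟨ +-monoʳ-< (offset len i) t< ⟩
  offset len (suc i)     ≤⟨ offset-mono len i<j ⟩
  offset len j           ≤⟨ m≤m+n _ t′ ⟩
  offset len j + t′      ∎
  where open ≤-Reasoning

offset-unique : ∀ len {i j t t′} → t < len i → t′ < len j → offset len i + t ≡ offset len j + t′ →
  i ≡ j × t ≡ t′
offset-unique len {i} {j} t< t′< eq with <-cmp i j
... | tri< i<j _ _ = ⊥-elim (<-irrefl eq (offset-< len i<j t<))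
... | tri> _ _ j<i = ⊥-elim (<-irrefl (sym eq) (offset-< len j<i t′<))
... | tri≈ _ refl _ = refl , +-cancelˡ-≡ (offset len i) _ _ eq

-- An interval 0 , … , offset len k − 1 cut into k blocks, the t-th element of block i being labelled
-- by the vertex name i t. A map into this interval that sends v to an element labelled v is injective.
record Blocks : Set where
  field
    k    : ℕ
    len  : ℕ → ℕ
    name : ℕ → ℕ → V

  data At : V → ℕ → Set where
    at : ∀ {v} i t → i < k → t < len i → v ≡ name i t → At v (offset len i + t)

  At-unique : ∀ {v w x y} → At v x → At w y → x ≡ y → v ≡ w
  At-unique (at i t _ t< refl) (at j t′ _ t′< refl) x≡y with offset-unique len t< t′< x≡y
  ... | refl , refl = refl

  At-bound : ∀ {v x} → At v x → x < offset len k
  At-bound (at i t i<k t< _) = ≤-trans (+-monoʳ-< (offset len i) t<) (offset-mono len i<k)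

-- 𝒫 orders the vertices by position, ℒ by the number x such that 1 + 2x (mod n) is the colour of the
-- edge to u; x exists because n is odd.
module Certified (r : ℕ) (α β : ℕ → ℕ) (s : ℕ) (𝒫 ℒ : Blocks) where
  open EvenBase r α β
  open Blocks

  module _ (𝒫-total : offset (len 𝒫) (k 𝒫) ≡ n) (ℒ-total : offset (len ℒ) (k ℒ) ≡ n)
    (positions : ∀ {v} → Ord v → ∃ λ x → At 𝒫 v x × pos v ≡ s + x)
    -- `d` and `e` put the multiples of `n` on whichever side avoids subtraction.
    (links : ∀ {v} → Ord v → ∃ λ x → ∃ λ d → ∃ λ e →
      At ℒ v x × pos v + pos (partner v) + d * n ≡ 1 + 2 * x + e * n) where

    window : ∀ {v} → Ord v → s ≤ pos v × pos v < s + n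
    window {v} o with positions o
    ... | x , at-x , pos≡ =
      ≤-trans (m≤m+n s x) (≤-reflexive (sym pos≡)) ,
      subst (_< s + n) (sym pos≡) (+-monoʳ-< s (subst (x <_) 𝒫-total (At-bound 𝒫 at-x)))

    pos-injective : ∀ {v w} → Ord v → Ord w → pos v ≡ pos w → v ≡ w
    pos-injective o o′ eq with positions o | positions o′
    ... | x , at-x , pos≡ | y , at-y , pos≡′ =
      At-unique 𝒫 at-x at-y (+-cancelˡ-≡ s x y (trans (sym pos≡) (trans eq pos≡′)))

    residue : ∀ a d b e → a + d * n ≡ b + e * n → a % n ≡ b % n
    residue a d b e eq = trans (sym ([m+kn]%n≡m%n a d n)) (trans (cong (_% n) eq) ([m+kn]%n≡m%n b e n))

    link-injective : ∀ {v w} → Ord v → Ord w → link v ≡ link w → v ≡ w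
    link-injective {v} {w} o o′ eq with links o | links o′
    ... | x , d , e , at-x , link≡ | y , d′ , e′ , at-y , link≡′ = At-unique ℒ at-x at-y
      (%-cancel 2 (odd-coprime-2 (2 + r)) 0 1 z≤n (subst (x <_) ℒ-total (At-bound ℒ at-x))
        z≤n (subst (y <_) ℒ-total (At-bound ℒ at-y))
        (trans (sym (residue (pos v + pos (partner v)) d (1 + 2 * x) e link≡))
          (trans eq (residue (pos w + pos (partner w)) d′ (1 + 2 * y) e′ link≡′))))

    open Labelled s window pos-injective link-injective public using (admissible)

next-suc : ∀ r {i} → i < 2 + r → Cycle.next r i ≡ suc i
next-suc r {i} i< with i ≟ 2 + r
... | yes refl = ⊥-elim (<-irrefl refl i<)
... | no _     = refl

next-last : ∀ r → Cycle.next r (2 + r) ≡ 0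
next-last r with 2 + r ≟ 2 + r
... | yes _ = refl
... | no ≢  = ⊥-elim (≢ refl)

-- m = 2q + 1 with q = 1 + p
module OddCycle (p : ℕ) where

  q : ℕ
  q = suc p

  -- Starting at index q, the cycle carries the consecutive labels 2q + 1 to 4q + 1. Its path sums
  -- are the odd numbers from 4q + 3 to 8q + 1, and the closing sum 6q + 2 is 2q + 1 modulo n = 4q +
  -- 1. The pendant vertices take 1 to 2q, so that their sums give the remaining odd numbers up to
  -- 4q + 1.
  α β : ℕ → ℕ
  α i with i <? q
  ... | yes _ = i + (3 * q + 2)
  ... | no _  = i + (q + 1)
  β i with i ≤? q
  ... | yes _ = i + q
  ... | no _  = i ∸ q

  α-low : ∀ {i} → i < q → α i ≡ i + (3 * q + 2)
  α-low {i} i< with i <? q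
  ... | yes _ = refl
  ... | no i≮ = ⊥-elim (i≮ i<)

  α-high : ∀ {i} → q ≤ i → α i ≡ i + (q + 1)
  α-high {i} i≥ with i <? q
  ... | yes i< = ⊥-elim (<⇒≱ i< i≥)
  ... | no _   = refl

  β-low : ∀ {i} → i ≤ q → β i ≡ i + q
  β-low {i} i≤ with i ≤? q
  ... | yes _ = refl
  ... | no i≰ = ⊥-elim (i≰ i≤)

  β-high : ∀ t → β (q + suc t) ≡ suc t
  β-high t with q + suc t ≤? q
  ... | yes ≤q = ⊥-elim (m+1+n≰m q ≤q)
  ... | no _   = m+n∸m≡n q (suc t)

  𝒫 ℒ : Blocks
  𝒫 = record { k = 4 ; len = len ; name = name }
    where
    len : ℕ → ℕ
    len 0 = p
    len 1 = suc q
    len 2 = suc q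
    len _ = q
    name : ℕ → ℕ → V
    name 0 t = B (q + suc t)
    name 1 t = B t
    name 2 t = A (q + t)
    name _ t = A t
  ℒ = record { k = 6 ; len = len ; name = name }
    where
    len : ℕ → ℕ
    len 0 = q
    len 1 = 1
    len 2 = p
    len 3 = 1
    len 4 = suc q
    len _ = p
    name : ℕ → ℕ → V
    name 0 t = B t
    name 1 t = A p
    name 2 t = B (q + suc t)
    name 3 t = B q
    name 4 t = A (q + t)
    name _ t = A t

  -- Cases by the pair of labels at an index and its successor: `mid` crosses between the two
  -- formulas for `α`, and `end` wraps round to 0.
  data AView : ℕ → Set where
    low  : ∀ {i} → i < p → AView i
    mid  : AView p
    high : ∀ t → t < q → AView (q + t)
    end  : AView (2 + (p + p))

  aView : ∀ i → i < 3 + (p + p) → AView i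
  aView i i< with <-cmp i p
  ... | tri< i<p _ _  = low i<p
  ... | tri≈ _ refl _ = mid
  ... | tri> _ _ p<i with m≤n⇒∃[o]m+o≡n p<i
  ...   | t , refl with t <? q
  ...     | yes t<q = high t t<q
  ...     | no t≮q  = subst AView (sym i≡) end
    where
    i≡ : q + t ≡ 2 + (p + p)
    i≡ = trans (cong (q +_) (≤-antisym (+-cancelˡ-≤ q t q (≤-trans (s≤s⁻¹ i<) (≤-reflexive (lem p)))) (≮⇒≥ t≮q))) (sym (lem p))
      where
      lem : ∀ p → 2 + (p + p) ≡ suc p + suc p
      lem = solve-∀

  data BView : ℕ → Set where
    low  : ∀ {i} → i < q → BView i
    mid  : BView q
    high : ∀ t → t < p → BView (q + suc t)

  bView : ∀ i → i < 2 + (p + p) → BView i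
  bView i i< with <-cmp i q
  ... | tri< i<q _ _  = low i<q
  ... | tri≈ _ refl _ = mid
  ... | tri> _ _ q<i with m≤n⇒∃[o]m+o≡n q<i
  ...   | t , refl = subst BView (+-suc q t) (high t (+-cancelˡ-< (2 + p) t p i<))

  open EvenBase (p + p) α β using (Ord; isA; isB; pos; partner; n)
  open Blocks

  positions : ∀ {v} → Ord v → ∃ λ x → At 𝒫 v x × pos v ≡ 1 + x
  positions (isA {i} i<) with aView i i<
  ... | low i<p = _ , at 3 i (≤ᵇ⇒≤ 4 4 tt) (<-trans i<p ≤-refl) refl , trans (α-low (<-trans i<p ≤-refl)) (lem p i)
    where
    lem : ∀ p i → i + (3 * suc p + 2) ≡ 1 + (p + (2 + p) + (2 + p) + i)
    lem = solve-∀
  ... | mid = _ , at 3 p (≤ᵇ⇒≤ 4 4 tt) ≤-refl refl , trans (α-low ≤-refl) (lem p)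
    where
    lem : ∀ p → p + (3 * suc p + 2) ≡ 1 + (p + (2 + p) + (2 + p) + p)
    lem = solve-∀
  ... | high t t<q = _ , at 2 t (≤ᵇ⇒≤ 3 4 tt) (<-trans t<q ≤-refl) refl , trans (α-high (m≤m+n q t)) (lem p t)
    where
    lem : ∀ p t → suc p + t + (suc p + 1) ≡ 1 + (p + (2 + p) + t)
    lem = solve-∀
  ... | end = _ , at 2 q (≤ᵇ⇒≤ 3 4 tt) ≤-refl (cong A (lem p)) , trans (α-high (≤-trans (m≤m+n q q) (≤-reflexive (sym (lem p))))) (lem′ p)
    where
    lem : ∀ p → 2 + (p + p) ≡ suc p + suc p
    lem = solve-∀
    lem′ : ∀ p → 2 + (p + p) + (suc p + 1) ≡ 1 + (p + (2 + p) + suc p)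
    lem′ = solve-∀
  positions (isB {i} i<) with bView i i<
  ... | low i<q = _ , at 1 i (≤ᵇ⇒≤ 2 4 tt) (<-trans i<q ≤-refl) refl , trans (β-low (<⇒≤ i<q)) (lem p i)
    where
    lem : ∀ p i → i + suc p ≡ 1 + (p + i)
    lem = solve-∀
  ... | mid = _ , at 1 q (≤ᵇ⇒≤ 2 4 tt) ≤-refl refl , β-low ≤-refl
  ... | high t t<p = _ , at 0 t (≤ᵇ⇒≤ 1 4 tt) t<p refl , β-high t

  links : ∀ {v} → Ord v → ∃ λ x → ∃ λ d → ∃ λ e →
    At ℒ v x × pos v + pos (partner v) + d * n ≡ 1 + 2 * x + e * n
  links (isA {i} i<) with aView i i<
  ... | low i<p = _ , 0 , 0 , at 5 i (≤ᵇ⇒≤ 6 6 tt) i<p refl ,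
        trans (cong (_+ 0) (cong₂ _+_ (α-low (<-trans i<p ≤-refl))
          (trans (cong α (next-suc (p + p) (<-trans i<p (s≤s (≤-trans (m≤m+n p p) (n≤1+n _)))))) (α-low (s≤s i<p))))) (lem p i)
    where
    lem : ∀ p i → i + (3 * suc p + 2) + (suc i + (3 * suc p + 2)) + 0 ≡
      1 + 2 * (suc p + 1 + p + 1 + (2 + p) + i) + 0
    lem = solve-∀
  -- The largest label meets the smallest label on the cycle: the sum 6q + 2 is even and becomes odd
  -- after one `n` is taken off.
  ... | mid = _ , 0 , 1 , at 1 0 (≤ᵇ⇒≤ 2 6 tt) z<s refl ,
        trans (cong (_+ 0) (cong₂ _+_ (α-low ≤-refl)
          (trans (cong α (next-suc (p + p) (s≤s (≤-trans (m≤m+n p p) (n≤1+n _))))) (α-high ≤-refl)))) (lem p)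
    where
    lem : ∀ p → p + (3 * suc p + 2) + (suc p + (suc p + 1)) + 0 ≡
      1 + 2 * (suc p + 0) + 1 * suc (2 * (2 + (p + p)))
    lem = solve-∀
  ... | high t t<q = _ , 0 , 0 , at 4 t (≤ᵇ⇒≤ 5 6 tt) (<-trans t<q ≤-refl) refl ,
        trans (cong (_+ 0) (cong₂ _+_ (α-high (m≤m+n q t))
          (trans (cong α (next-suc (p + p) (≤-trans (+-monoʳ-< q t<q) (≤-reflexive (lem p)))))
            (α-high (≤-trans (m≤m+n q t) (n≤1+n _)))))) (lem′ p t)
    where
    lem : ∀ p → suc p + suc p ≡ 2 + (p + p)
    lem = solve-∀
    lem′ : ∀ p t → suc p + t + (suc p + 1) + (suc (suc p + t) + (suc p + 1)) + 0 ≡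
      1 + 2 * (suc p + 1 + p + 1 + t) + 0
    lem′ = solve-∀
  -- The label at index 0 is one more than the label at the last index, so the wrap-around continues
  -- the progression of `high`.
  ... | end = _ , 0 , 0 , at 4 q (≤ᵇ⇒≤ 5 6 tt) ≤-refl (cong A (lem p)) ,
        trans (cong (_+ 0) (cong₂ _+_ (α-high (≤-trans (m≤m+n q q) (≤-reflexive (sym (lem p)))))
          (trans (cong α (next-last (p + p))) (α-low z<s)))) (lem′ p)
    where
    lem : ∀ p → 2 + (p + p) ≡ suc p + suc p
    lem = solve-∀
    lem′ : ∀ p → 2 + (p + p) + (suc p + 1) + (0 + (3 * suc p + 2)) + 0 ≡
      1 + 2 * (suc p + 1 + p + 1 + suc p) + 0
    lem′ = solve-∀
  links (isB {i} i<) with bView i i<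
  ... | low i<q = _ , 0 , 1 , at 0 i (≤ᵇ⇒≤ 1 6 tt) i<q refl ,
        trans (cong (_+ 0) (cong₂ _+_ (β-low (<⇒≤ i<q)) (α-low i<q))) (lem p i)
    where
    lem : ∀ p i → i + suc p + (i + (3 * suc p + 2)) + 0 ≡ 1 + 2 * (0 + i) + 1 * suc (2 * (2 + (p + p)))
    lem = solve-∀
  ... | mid = _ , 0 , 0 , at 3 0 (≤ᵇ⇒≤ 4 6 tt) z<s refl ,
        trans (cong (_+ 0) (cong₂ _+_ (β-low {q} ≤-refl) (α-high ≤-refl))) (lem p)
    where
    lem : ∀ p → suc p + suc p + (suc p + (suc p + 1)) + 0 ≡ 1 + 2 * (suc p + 1 + p + 0) + 0
    lem = solve-∀
  ... | high t t<p = _ , 0 , 0 , at 2 t (≤ᵇ⇒≤ 3 6 tt) t<p refl ,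
        trans (cong (_+ 0) (cong₂ _+_ (β-high t) (α-high (m≤m+n q (suc t))))) (lem p t)
    where
    lem : ∀ p t → suc t + (suc p + suc t + (suc p + 1)) + 0 ≡ 1 + 2 * (suc p + 1 + t) + 0
    lem = solve-∀

  𝒫-total : offset (len 𝒫) 4 ≡ n
  𝒫-total = lem p
    where
    lem : ∀ p → p + (2 + p) + (2 + p) + suc p ≡ suc (2 * (2 + (p + p)))
    lem = solve-∀

  ℒ-total : offset (len ℒ) 6 ≡ n
  ℒ-total = lem p
    where
    lem : ∀ p → suc p + 1 + p + 1 + (2 + p) + p ≡ suc (2 * (2 + (p + p)))
    lem = solve-∀

  open Certified (p + p) α β 1 𝒫 ℒ using (admissible)

  oddCycle-admissible = admissible 𝒫-total ℒ-total positions links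

-- m = 2q with q = 2 + p
module EvenCycle (p : ℕ) where

  q r : ℕ
  q = 2 + p
  r = suc (p + p)

  -- On an even cycle with consecutive labels the closing sum would repeat the middle path sum.
  -- Instead, modulo n = 4q - 1, the cycle carries 1 to q - 1, then -q to -1, and finally 2q. The
  -- jump between the runs gives the sum -1, and the last vertex gives 2q - 1 and 2q + 1. Together
  -- with the sums inside the two runs this leaves 1 and the odd numbers from 2q + 3 to 6q - 3 for
  -- the pendant edges.
  α β : ℕ → ℕ
  α i with i <? suc p | i ≟ 2 + r
  ... | yes _ | _     = suc i
  ... | no _  | yes _ = 2 * q
  ... | no _  | no _  = i + 2 * q
  β zero    = zero
  β (suc i) with i <? p
  ... | yes _ = suc i + 2 * q
  ... | no _  = suc (suc i)

  α-low : ∀ {i} → i < suc p → α i ≡ suc i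
  α-low {i} i< with i <? suc p
  ... | yes _ = refl
  ... | no i≮ = ⊥-elim (i≮ i<)

  α-high : ∀ {i} → suc p ≤ i → i < 2 + r → α i ≡ i + 2 * q
  α-high {i} i≥ i< with i <? suc p | i ≟ 2 + r
  ... | yes i<p | _       = ⊥-elim (<⇒≱ i<p i≥)
  ... | no _    | yes i≡  = ⊥-elim (<-irrefl i≡ i<)
  ... | no _    | no _    = refl

  α-last : α (2 + r) ≡ 2 * q
  α-last with 2 + r <? suc p | 2 + r ≟ 2 + r
  ... | yes <p | _     = ⊥-elim (<⇒≱ <p (s≤s (≤-trans (m≤m+n p p) (≤-trans (n≤1+n _) (n≤1+n _)))))
  ... | no _   | yes _ = refl
  ... | no _   | no ≢  = ⊥-elim (≢ refl)

  β-low : ∀ {t} → t < p → β (suc t) ≡ suc t + 2 * q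
  β-low {t} t< with t <? p
  ... | yes _ = refl
  ... | no t≮ = ⊥-elim (t≮ t<)

  β-high : ∀ t → β (suc (p + t)) ≡ suc (suc (p + t))
  β-high t with p + t <? p
  ... | yes <p = ⊥-elim (<⇒≱ <p (m≤m+n p t))
  ... | no _  = refl

  𝒫 ℒ : Blocks
  𝒫 = record { k = 6 ; len = len ; name = name }
    where
    len : ℕ → ℕ
    len 0 = 1
    len 1 = suc p
    len 2 = q
    len 3 = 1
    len 4 = p
    len _ = q
    name : ℕ → ℕ → V
    name 0 t = B 0
    name 1 t = A t
    name 2 t = B (suc (p + t))
    name 3 t = A (2 + r)
    name 4 t = B (suc t)
    name _ t = A (suc p + t)
  ℒ = record { k = 7 ; len = len ; name = name }
    where
    len : ℕ → ℕ
    len 0 = 1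
    len 1 = p
    len 2 = 1
    len 3 = 1
    -- Both formulas for `β` at positive indices produce one progression of sums, hence a single
    -- block.
    len 4 = p + q
    len 5 = suc p
    len _ = 1
    name : ℕ → ℕ → V
    name 0 t = B 0
    name 1 t = A t
    name 2 t = A (1 + r)
    name 3 t = A (2 + r)
    name 4 t = B (suc t)
    name 5 t = A (suc p + t)
    name _ t = A p

  data AView : ℕ → Set where
    low         : ∀ {i} → i < p → AView i
    mid         : AView p
    high        : ∀ t → t < suc p → AView (suc p + t)
    penultimate : AView (1 + r)
    end         : AView (2 + r)

  aView : ∀ i → i < 3 + r → AView i
  aView i i< with <-cmp i p
  ... | tri< i<p _ _  = low i<p
  ... | tri≈ _ refl _ = mid
  ... | tri> _ _ p<i with m≤n⇒∃[o]m+o≡n p<i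
  ...   | t , refl with <-cmp t (suc p)
  ...     | tri< t< _ _    = high t t<
  ...     | tri≈ _ refl _  = subst AView (cong suc (sym (+-suc p p))) penultimate
  ...     | tri> _ _ t>    = subst AView (sym i≡) end
    where
    lem : ∀ p → 3 + (p + p) ≡ suc p + (2 + p)
    lem = solve-∀
    i≡ : suc p + t ≡ 2 + r
    i≡ = ≤-antisym (s≤s⁻¹ i<) (≤-trans (≤-reflexive (lem p)) (+-monoʳ-≤ (suc p) t>))

  data BView : ℕ → Set where
    first : BView 0
    low   : ∀ t → t < p → BView (suc t)
    high  : ∀ t → t < q → BView (suc (p + t))

  bView : ∀ i → i < 2 + r → BView i
  bView zero    _ = first
  bView (suc i) i< with i <? p
  ... | yes i<p = low i i<p
  ... | no i≮p with m≤n⇒∃[o]m+o≡n (≮⇒≥ i≮p)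
  ...   | t , refl = high t (+-cancelˡ-< p t q (≤-trans (s≤s⁻¹ i<) (≤-reflexive (lem p))))
    where
    lem : ∀ p → 2 + (p + p) ≡ p + (2 + p)
    lem = solve-∀

  open EvenBase r α β using (Ord; isA; isB; pos; partner; n)
  open Blocks

  p<last : p < 2 + r
  p<last = s≤s (≤-trans (m≤m+n p p) (≤-trans (n≤1+n _) (n≤1+n _)))

  positions : ∀ {v} → Ord v → ∃ λ x → At 𝒫 v x × pos v ≡ 0 + x
  positions (isA {i} i<) with aView i i<
  ... | low i<p = _ , at 1 i (≤ᵇ⇒≤ 2 6 tt) (<-trans i<p ≤-refl) refl , α-low (<-trans i<p ≤-refl)
  ... | mid = _ , at 1 p (≤ᵇ⇒≤ 2 6 tt) ≤-refl refl , α-low ≤-refl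
  ... | high t t< = _ , at 5 t (≤ᵇ⇒≤ 6 6 tt) (<-trans t< ≤-refl) refl ,
        trans (α-high (m≤m+n (suc p) t) (<-trans (+-monoʳ-< (suc p) t<) (≤-reflexive (lem p)))) (lem′ p t)
    where
    lem : ∀ p → suc (suc p + suc p) ≡ 2 + suc (p + p)
    lem = solve-∀
    lem′ : ∀ p t → suc p + t + 2 * (2 + p) ≡ 1 + suc p + (2 + p) + 1 + p + t
    lem′ = solve-∀
  ... | penultimate = _ , at 5 (suc p) (≤ᵇ⇒≤ 6 6 tt) ≤-refl (cong (A ∘ suc) (sym (+-suc p p))) ,
        trans (α-high (s≤s (≤-trans (m≤m+n p p) (n≤1+n _))) ≤-refl) (lem p)
    where
    lem : ∀ p → 1 + suc (p + p) + 2 * (2 + p) ≡ 1 + suc p + (2 + p) + 1 + p + suc p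
    lem = solve-∀
  ... | end = _ , at 3 0 (≤ᵇ⇒≤ 4 6 tt) z<s refl , trans α-last (lem p)
    where
    lem : ∀ p → 2 * (2 + p) ≡ 1 + suc p + (2 + p) + 0
    lem = solve-∀
  positions (isB {i} i<) with bView i i<
  ... | first = _ , at 0 0 (≤ᵇ⇒≤ 1 6 tt) z<s refl , refl
  ... | low t t<p = _ , at 4 t (≤ᵇ⇒≤ 5 6 tt) t<p refl , trans (β-low t<p) (lem p t)
    where
    lem : ∀ p t → suc t + 2 * (2 + p) ≡ 1 + suc p + (2 + p) + 1 + t
    lem = solve-∀
  ... | high t t<q = _ , at 2 t (≤ᵇ⇒≤ 3 6 tt) t<q refl , β-high t

  links : ∀ {v} → Ord v → ∃ λ x → ∃ λ d → ∃ λ e →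
    At ℒ v x × pos v + pos (partner v) + d * n ≡ 1 + 2 * x + e * n
  links (isA {i} i<) with aView i i<
  ... | low i<p = _ , 0 , 0 , at 1 i (≤ᵇ⇒≤ 2 7 tt) i<p refl ,
        trans (cong (_+ 0) (cong₂ _+_ (α-low (<-trans i<p ≤-refl))
          (trans (cong α (next-suc r (<-trans i<p p<last))) (α-low (s≤s i<p))))) (lem i)
    where
    lem : ∀ i → suc i + suc (suc i) + 0 ≡ 1 + 2 * (1 + i) + 0
    lem = solve-∀
  -- The sum 4q - 2 is even; adding one `n` makes it 8q - 3, the odd number with x = n - 1.
  ... | mid = _ , 1 , 0 , at 6 0 (≤ᵇ⇒≤ 7 7 tt) z<s refl ,
        trans (cong (_+ 1 * n) (cong₂ _+_ (α-low ≤-refl)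
          (trans (cong α (next-suc r p<last)) (α-high ≤-refl (s≤s (s≤s (≤-trans (m≤m+n p p) (n≤1+n _)))))))) (lem p)
    where
    lem : ∀ p → suc p + (suc p + 2 * (2 + p)) + 1 * suc (2 * (2 + suc (p + p))) ≡
      1 + 2 * (1 + p + 1 + 1 + (p + (2 + p)) + suc p + 0) + 0
    lem = solve-∀
  ... | high t t< = _ , 0 , 0 , at 5 t (≤ᵇ⇒≤ 6 7 tt) t< refl ,
        trans (cong (_+ 0) (cong₂ _+_ (α-high (m≤m+n (suc p) t) (<-trans below ≤-refl))
          (trans (cong α (next-suc r (<-trans below ≤-refl)))
            (α-high (≤-trans (m≤m+n (suc p) t) (n≤1+n _)) (s≤s below))))) (lem′ p t)
    where
    lem : ∀ p → suc p + suc p ≡ 1 + suc (p + p)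
    lem = solve-∀
    below : suc p + t < 1 + r
    below = ≤-trans (+-monoʳ-< (suc p) t<) (≤-reflexive (lem p))
    lem′ : ∀ p t → suc p + t + 2 * (2 + p) + (suc (suc p + t) + 2 * (2 + p)) + 0 ≡
      1 + 2 * (1 + p + 1 + 1 + (p + (2 + p)) + t) + 0
    lem′ = solve-∀
  ... | penultimate = _ , 0 , 1 , at 2 0 (≤ᵇ⇒≤ 3 7 tt) z<s refl ,
        trans (cong (_+ 0) (cong₂ _+_ (α-high (s≤s (≤-trans (m≤m+n p p) (n≤1+n _))) ≤-refl)
          (trans (cong α (next-suc r ≤-refl)) α-last))) (lem p)
    where
    lem : ∀ p → 1 + suc (p + p) + 2 * (2 + p) + 2 * (2 + p) + 0 ≡
      1 + 2 * (1 + p + 0) + 1 * suc (2 * (2 + suc (p + p)))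
    lem = solve-∀
  ... | end = _ , 0 , 0 , at 3 0 (≤ᵇ⇒≤ 4 7 tt) z<s refl ,
        trans (cong (_+ 0) (cong₂ _+_ α-last (trans (cong α (next-last r)) (α-low z<s)))) (lem p)
    where
    lem : ∀ p → 2 * (2 + p) + 1 + 0 ≡ 1 + 2 * (1 + p + 1 + 0) + 0
    lem = solve-∀
  links (isB {i} i<) with bView i i<
  ... | first = _ , 0 , 0 , at 0 0 (≤ᵇ⇒≤ 1 7 tt) z<s refl , cong (_+ 0) (α-low z<s)
  ... | low t t<p = _ , 0 , 0 , at 4 t (≤ᵇ⇒≤ 5 7 tt) (≤-trans t<p (m≤m+n p q)) refl ,
        trans (cong (_+ 0) (cong₂ _+_ (β-low t<p) (α-low (s≤s t<p)))) (lem p t)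
    where
    lem : ∀ p t → suc t + 2 * (2 + p) + suc (suc t) + 0 ≡ 1 + 2 * (1 + p + 1 + 1 + t) + 0
    lem = solve-∀
  ... | high t t<q = _ , 0 , 0 , at 4 (p + t) (≤ᵇ⇒≤ 5 7 tt) (+-monoʳ-< p t<q) refl ,
        trans (cong (_+ 0) (cong₂ _+_ (β-high t) (α-high (m≤m+n (suc p) t) i<))) (lem p t)
    where
    lem : ∀ p t → suc (suc (p + t)) + (suc p + t + 2 * (2 + p)) + 0 ≡ 1 + 2 * (1 + p + 1 + 1 + (p + t)) + 0
    lem = solve-∀

  𝒫-total : offset (len 𝒫) 6 ≡ n
  𝒫-total = lem p
    where
    lem : ∀ p → 1 + suc p + (2 + p) + 1 + p + (2 + p) ≡ suc (2 * (2 + suc (p + p)))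
    lem = solve-∀

  ℒ-total : offset (len ℒ) 7 ≡ n
  ℒ-total = lem p
    where
    lem : ∀ p → 1 + p + 1 + 1 + (p + (2 + p)) + suc p + 1 ≡ suc (2 * (2 + suc (p + p)))
    lem = solve-∀

  open Certified r α β 0 𝒫 ℒ using (admissible)

  evenCycle-admissible = admissible 𝒫-total ℒ-total positions links

-- The cycle length is 3 + r, so even `r` calls for the odd cycle and odd `r` for the even one.
even-admissible : ∀ r → ∃ λ e →
  Admissible (3 + (r + (2 + r + 2))) (broom (2 + (r + (2 + r + 2)))) e ×
  (2 + (r + (2 + r + 2))) * (2 + (r + (2 + r + 2))) ≤ 2 * e
even-admissible r with halve r
  where
  halve : ∀ r → ∃ λ p → r ≡ p + p ⊎ r ≡ suc (p + p)
  halve zero = 0 , inj₁ refl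
  halve (suc r) with halve r
  ... | p , inj₁ refl = p , inj₂ refl
  ... | p , inj₂ refl = suc p , inj₁ (cong suc (sym (+-suc p p)))
... | p , inj₁ refl = OddCycle.oddCycle-admissible p
... | p , inj₂ refl = EvenCycle.evenCycle-admissible p

-- Assembling the three cases

asymptotics : ∀ a b {l K e} .{{_ : NonZero K}} →
  (∀ {n} (G : Graph n) (c : Colouring n) → Proper G c → RainbowFree G c (broom (2 + l)) →
    b * edgeCount G ≤ a * n) →
  Admissible K (broom (2 + l)) e → a * K ≤ b * e → ExStarBroomAsymp (2 + l) a b
asymptotics a b {K = K} bound base dense = a * K , λ n →
  (λ { _ (G , c , proper , free , refl) → ≤-trans (bound G c proper free) (m≤m+n _ (a * K)) }) ,
  lower {a = a} {b = b} base dense n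

asymptotics-odd : ∀ k → 2 ≤ k → Odd k → ExStarBroomAsymp k k 2
asymptotics-odd k 2≤k@(s≤s (s≤s {n = l} z≤n)) k-odd = asymptotics k 2
  (λ G c proper free → upper-odd G c proper free 2≤k)
  (oddClique-admissible l k-odd)
  (≤-reflexive (sym (complete-edgeCount (2 + l))))

asymptotics-2-4 : ∀ k → k ≡ 2 ⊎ k ≡ 4 → ExStarBroomAsymp k (k ∸ 1) 2
asymptotics-2-4 k (inj₁ refl) = asymptotics 1 2
  (λ G c proper free → upper-2-4 G c proper free (inj₁ refl))
  (clique-admissible 2) (≤-reflexive (sym (complete-edgeCount 1)))
asymptotics-2-4 k (inj₂ refl) = asymptotics 3 2
  (λ G c proper free → upper-2-4 G c proper free (inj₂ refl))
  (clique-admissible 4) (≤-reflexive (sym (complete-edgeCount 3)))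

asymptotics-even : ∀ k → Even k → 6 ≤ k → ExStarBroomAsymp k (k * k) (2 * (k + 1))
asymptotics-even k (j , k≡2j) 6≤k with m≤n⇒∃[o]m+o≡n (*-cancelˡ-≤ {3} {j} 2 (subst (6 ≤_) k≡2j 6≤k))
... | r , refl = subst (λ k → ExStarBroomAsymp k (k * k) (2 * (k + 1))) (sym k≡) result
  where
  l = r + (2 + r + 2)
  k≡ : k ≡ 2 + l
  k≡ = trans k≡2j (lem r)
    where
    lem : ∀ r → 2 * (3 + r) ≡ 2 + (r + (2 + r + 2))
    lem = solve-∀
  result : ExStarBroomAsymp (2 + l) ((2 + l) * (2 + l)) (2 * (2 + l + 1))
  result with even-admissible r
  ... | e , base , dense = asymptotics ((2 + l) * (2 + l)) (2 * (2 + l + 1))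
    (λ G c proper free → upper-even G c proper free (3 + r , trans (sym k≡) k≡2j) (subst (6 ≤_) k≡ 6≤k))
    base (begin
      (2 + l) * (2 + l) * (3 + l)   ≡⟨ *-comm ((2 + l) * (2 + l)) (3 + l) ⟩
      (3 + l) * ((2 + l) * (2 + l)) ≤⟨ *-monoʳ-≤ (3 + l) dense ⟩
      (3 + l) * (2 * e)             ≡⟨ lem l e ⟩
      2 * (2 + l + 1) * e           ∎)
    where
    open ≤-Reasoning
    lem : ∀ l e → (3 + l) * (2 * e) ≡ 2 * (2 + l + 1) * e
    lem = solve-∀

theorem2 : ∀ (k : ℕ) → 2 ≤ k →
    (Odd k → ExStarBroomAsymp k k 2) ×
    ((k ≡ 2 ⊎ k ≡ 4) → ExStarBroomAsymp k (k ∸ 1) 2) ×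
    (Even k → 6 ≤ k → ExStarBroomAsymp k (k * k) (2 * (k + 1)))
theorem2 k 2≤k = asymptotics-odd k 2≤k , asymptotics-2-4 k , asymptotics-even k
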